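{- For every $N\ge 1$, the family of lollipop graphs $\{L_{m,n}\}$ on $m+n=N$ vertices (with $m\geq 1$, $n\ge 0$) forms a chain in the poset $\mathcal{E}_N$. In particular, for $m\geq 3$ and $n\geq 0$, $$L_{m-1,n+1}\geq_e L_{m,n}.$$ Hence, the path $P_N$ is the maximal element and the complete graph $K_N$ is the minimal element of the chain.
   Context: All graphs are finite and simple. For $m\ge1$, $n\ge0$ and $N=m+n$, the lollipop graph $L_{m,n}$ is the graph on vertex set $\{1,\dots,N\}$ with all edges between distinct vertices in $\{1,\dots,m\}$ and the edges joining $i$ and $i+1$ for $m\le i\le N-1$. Thus $L_{N,0}=K_N$ is the complete graph and $L_{1,N-1}=P_N$ is the path on $N$ vertices. The chromatic symmetric function of a graph $G$ with vertices $v_1,\dots,v_N$ is $X_G=\sum_{\kappa}x_{\kappa(v_1)}\cdots x_{\kappa(v_N)}$, summed over all proper colorings $\kappa:V(G)\to\{1,2,3,\dots\}$; it is a homogeneous symmetric function of degree $N$ over $\mathbb{Q}$. Let $e_\lambda=e_{\lambda_1}e_{\lambda_2}\cdots$ be the elementary symmetric functions; $[e_\lambda]F$ denotes the coefficient of $e_\lambda$ in $F$ expanded in this basis, and $F$ is $e$-positive if $[e_\lambda]F\ge 0$ for all $\lambda$. For connected graphs $G,H$ on $N$ vertices (for which $[e_{(N)}]X_G$ and $[e_{(N)}]X_H$ are positive), set $$X_e(G,H)=X_G-\frac{[e_{(N)}]X_G}{[e_{(N)}]X_H}X_H.$$ $\mathcal{E}_N$ is the poset whose elements are the equivalence classes of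 connected graphs on $N$ vertices under $G\sim H\iff X_G=X_H$, ordered by $G\geq_e H$ if and only if $X_e(G,H)$ is $e$-positive. A chain is a set of pairwise comparable elements. -}

module Defs where

open import Data.Bool.Base using (if_then_else_)
open import Data.Fin.Base as Fin using (Fin; toℕ)
import Data.Fin.Properties as Fin
open import Data.List.Base as List
  using (List; []; _∷_; map; foldr; filter; concatMap; cartesianProductWith; allFin; upTo)
open import Data.List.Membership.Propositional using () renaming (_∈_ to _∈ˡ_)
open import Data.List.Relation.Unary.Linked using (linked?)
open import Data.Nat.Base as ℕ using (ℕ; zero; suc; _≤_)
import Data.Nat.Properties as ℕ
open import Data.Product using (Σ-syntax; ∃-syntax; _×_; _,_)
open import Data.Rational.Base as ℚ using (ℚ; 0ℚ; 1ℚ)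
open import Data.Sum.Base using (_⊎_; inj₁; inj₂; swap)
open import Data.Vec.Base as Vec using (Vec; []; _∷_; lookup; tabulate; count; zipWith)
import Data.Vec.Properties as Vec
open import Data.Vec.Relation.Unary.All as All using ()
open import Level using (0ℓ)
open import Relation.Binary.Construct.Closure.ReflexiveTransitive
  using (Star; ε; _◅_; _◅◅_; reverse)
open import Relation.Binary.Core using (Rel)
open import Relation.Binary.Definitions using (Decidable; Symmetric; Irreflexive)
open import Relation.Binary.PropositionalEquality
  using (_≡_; _≢_; refl; sym; trans; cong; subst; ≢-sym)
open import Relation.Nullary.Decidable using (Dec; does; yes; no; ¬?; _×-dec_; _⊎-dec_; _→-dec_)
open import Relation.Unary using (Pred; _∈_)

------------------------------------------------------------------------
-- Graphs

record Graph (N : ℕ) : Set₁ where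
  infix 4 _~_ _~?_
  field
    _~_      : Rel (Fin N) 0ℓ
    _~?_     : Decidable _~_
    ~-sym    : Symmetric _~_
    ~-irrefl : Irreflexive _≡_ _~_

Connected : ∀ {N} → Graph N → Set
Connected G = ∀ u v → Star (Graph._~_ G) u v

record ConnectedGraph (N : ℕ) : Set₁ where
  field
    graph     : Graph N
    connected : Connected graph
  open Graph graph public

open ConnectedGraph using (graph; connected)

-- The vertices 1, …, N are the elements of Fin N, shifted by one.
label : ∀ {N} → Fin N → ℕ
label i = suc (toℕ i)

module _ {N : ℕ} (G : Graph N)
         (consecutive : ∀ i j → label j ≡ suc (label i) → Graph._~_ G i j) where

  open Graph G

  private
    ascend : ∀ d i j → toℕ j ≡ d ℕ.+ toℕ i → Star _~_ i j
    ascend zero    i j eq = subst (Star _~_ i) (Fin.toℕ-injective (sym eq)) ε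
    ascend (suc d) i j eq =
      ascend d i k (Fin.toℕ-fromℕ< k<N)
        ◅◅ (consecutive k j
              (cong suc (trans eq (cong suc (sym (Fin.toℕ-fromℕ< k<N))))) ◅ ε)
      where
      k<N : d ℕ.+ toℕ i ℕ.< N
      k<N = ℕ.<-trans (ℕ.≤-reflexive (sym eq)) (Fin.toℕ<n j)
      k   = Fin.fromℕ< k<N

  consecutive⇒connected : Connected G
  consecutive⇒connected u v with ℕ.≤-total (toℕ u) (toℕ v)
  ... | inj₁ u≤v = ascend (toℕ v ℕ.∸ toℕ u) u v (sym (ℕ.m∸n+n≡m u≤v))
  ... | inj₂ v≤u = reverse ~-sym (ascend (toℕ u ℕ.∸ toℕ v) v u (sym (ℕ.m∸n+n≡m v≤u)))

-- L m n eq is the lollipop graph L_{m,n}, as a graph on N = m + n vertices.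
module _ {N : ℕ} (m n : ℕ) (m+n≡N : m ℕ.+ n ≡ N) where

  CliqueEdge TailEdge LollipopEdge : Rel (Fin N) 0ℓ
  CliqueEdge   i j = i ≢ j × label i ≤ m × label j ≤ m
  TailEdge     i j = m ≤ label i × label j ≡ suc (label i)
  LollipopEdge i j = CliqueEdge i j ⊎ TailEdge i j ⊎ TailEdge j i

  private
    clique? : Decidable CliqueEdge
    clique? i j = ¬? (i Fin.≟ j) ×-dec (label i ℕ.≤? m) ×-dec (label j ℕ.≤? m)

    tail? : Decidable TailEdge
    tail? i j = (m ℕ.≤? label i) ×-dec (label j ℕ.≟ suc (label i))

    lollipop : Graph N
    lollipop = record
      { _~_      = LollipopEdge
      ; _~?_     = λ i j → clique? i j ⊎-dec tail? i j ⊎-dec tail? j i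
      ; ~-sym    = λ { (inj₁ (i≢j , i≤m , j≤m)) → inj₁ (≢-sym i≢j , j≤m , i≤m)
                     ; (inj₂ t)                 → inj₂ (swap t) }
      ; ~-irrefl = λ { refl (inj₁ (i≢i , _))        → i≢i refl
                     ; refl (inj₂ (inj₁ (_ , eq))) → ℕ.1+n≢n (sym eq)
                     ; refl (inj₂ (inj₂ (_ , eq))) → ℕ.1+n≢n (sym eq) }
      }

    consecutive : ∀ i j → label j ≡ suc (label i) → LollipopEdge i j
    consecutive i j eq with m ℕ.≤? label i
    ... | yes m≤i = inj₂ (inj₁ (m≤i , eq))
    ... | no  m≰i = inj₁ ((λ { refl → ℕ.1+n≢n (sym eq) })
                         , ℕ.<⇒≤ (ℕ.≰⇒> m≰i)
                         , subst (_≤ m) (sym eq) (ℕ.≰⇒> m≰i))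

  L : ConnectedGraph N
  L = record { graph = lollipop ; connected = consecutive⇒connected lollipop consecutive }

K : ∀ N → ConnectedGraph N
K N = record
  { graph     = complete
  ; connected = consecutive⇒connected complete λ { i _ eq refl → ℕ.1+n≢n (sym eq) }
  }
  where
  complete : Graph N
  complete = record
    { _~_      = _≢_
    ; _~?_     = λ i j → ¬? (i Fin.≟ j)
    ; ~-sym    = ≢-sym
    ; ~-irrefl = λ eq i≢j → i≢j eq
    }

P : ∀ N → ConnectedGraph N
P N = record
  { graph     = path
  ; connected = consecutive⇒connected path λ _ _ → inj₁
  }
  where
  path : Graph N
  path = record
    { _~_      = λ i j → label j ≡ suc (label i) ⊎ label i ≡ suc (label j)
    ; _~?_     = λ i j → (label j ℕ.≟ suc (label i)) ⊎-dec (label i ℕ.≟ suc (label j))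
    ; ~-sym    = swap
    ; ~-irrefl = λ { refl (inj₁ eq) → ℕ.1+n≢n (sym eq)
                   ; refl (inj₂ eq) → ℕ.1+n≢n (sym eq) }
    }

------------------------------------------------------------------------
-- Formal power series over ℚ in x₁, x₂, …

-- A series is given by its coefficients: F k (a₁ ∷ … ∷ aₖ ∷ []) is the
-- coefficient of x₁^a₁ ⋯ xₖ^aₖ.  Every monomial has this form for some k.
Series : Set
Series = ∀ k → Vec ℕ k → ℚ

infix 4 _≈ˢ_
_≈ˢ_ : Series → Series → Set
F ≈ˢ G = ∀ k α → F k α ≡ G k α

∑ : ∀ {A : Set} → List A → (A → ℚ) → ℚ
∑ xs f = foldr ℚ._+_ 0ℚ (map f xs)

infixl 6 _-ˢ_
_-ˢ_ : Series → Series → Series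
(F -ˢ G) k α = F k α ℚ.- G k α

infixr 7 _•_ _·_
_•_ : ℚ → Series → Series
(q • F) k α = q ℚ.* F k α

-- All β ≤ α, componentwise.
below : ∀ {k} → Vec ℕ k → List (Vec ℕ k)
below []      = [] ∷ []
below (a ∷ α) = cartesianProductWith _∷_ (upTo (suc a)) (below α)

_·_ : Series → Series → Series
(F · G) k α = ∑ (below α) λ β → F k β ℚ.* G k (zipWith ℕ._∸_ α β)

------------------------------------------------------------------------
-- Chromatic symmetric functions

-- All maps from N vertices to k colours.
colorings : ∀ N k → List (Vec (Fin k) N)
colorings zero    k = [] ∷ []
colorings (suc N) k = cartesianProductWith _∷_ (allFin k) (colorings N k)

-- The exponent vector of x_{κ(v₁)} ⋯ x_{κ(v_N)}.
content : ∀ {N k} → Vec (Fin k) N → Vec ℕ k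
content κ = tabulate λ c → count (c Fin.≟_) κ

monomialCoeff : ∀ {N k} → Vec (Fin k) N → Vec ℕ k → ℚ
monomialCoeff κ α = if does (Vec.≡-dec ℕ._≟_ (content κ) α) then 1ℚ else 0ℚ

module _ {N : ℕ} (G : Graph N) where
  open Graph G

  Proper : ∀ {k} → Pred (Vec (Fin k) N) 0ℓ
  Proper κ = ∀ i j → i ~ j → lookup κ i ≢ lookup κ j

  proper? : ∀ {k} (κ : Vec (Fin k) N) → Dec (Proper κ)
  proper? κ = Fin.all? λ i → Fin.all? λ j →
    (i ~? j) →-dec ¬? (lookup κ i Fin.≟ lookup κ j)

  -- Only colorings with values in the first k colours contribute to a
  -- coefficient of a monomial in x₁, …, xₖ, so the sum is finite.
  X : Series
  X k α = ∑ (filter proper? (colorings N k)) λ κ → monomialCoeff κ α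

------------------------------------------------------------------------
-- Elementary symmetric functions and e-expansions

-- e_r is the sum of all squarefree monomials of degree r; in particular e₀ = 1.
elem : ℕ → Series
elem r k α = if does (All.all? (ℕ._≤? 1) α ×-dec (Vec.sum α ℕ.≟ r)) then 1ℚ else 0ℚ

e : List ℕ → Series
e = foldr (λ r F → elem r · F) (elem 0)

-- Every composition of n + 1 arises from exactly one composition of n, by
-- prepending a part 1 or by increasing the first part.
compositions : ℕ → List (List ℕ)
compositions zero    = [] ∷ []
compositions (suc n) = concatMap extend (compositions n)
  where
  extend : List ℕ → List (List ℕ)
  extend []       = (1 ∷ []) ∷ []
  extend (a ∷ as) = (1 ∷ a ∷ as) ∷ (suc a ∷ as) ∷ []

partitions : ℕ → List (List ℕ)
partitions n = filter (linked? ℕ._≥?_) (compositions n)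

-- The expansion of F, homogeneous of degree N, in the basis (e_λ) with λ ⊢ N.
-- As this is a basis, the values of coeff on the partitions of N are determined
-- by F: coeff λ is [e_λ]F.  Values of coeff elsewhere are irrelevant.
record EExpansion (N : ℕ) (F : Series) : Set where
  field
    coeff   : List ℕ → ℚ
    expands : ∀ k α → F k α ≡ ∑ (partitions N) λ lam → coeff lam ℚ.* e lam k α

open EExpansion public

EPositive : ℕ → Series → Set
EPositive N F = Σ[ E ∈ EExpansion N F ] (∀ lam → lam ∈ˡ partitions N → 0ℚ ℚ.≤ coeff E lam)

------------------------------------------------------------------------
-- The poset ℰ_N: connected graphs on N vertices, with equality _∼_ and
-- order _≥ₑ_

module _ {N : ℕ} where

  infix 4 _∼_ _≥ₑ_

  _∼_ : Rel (ConnectedGraph N) 0ℓ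
  G ∼ H = X (graph G) ≈ˢ X (graph H)

  module _ (G H : ConnectedGraph N)
           (E : EExpansion N (X (graph G))) (F : EExpansion N (X (graph H))) where

    Xₑ : .{{ℚ.NonZero (coeff F (N ∷ []))}} → Series
    Xₑ = X (graph G) -ˢ (coeff E (N ∷ []) ℚ.÷ coeff F (N ∷ [])) • X (graph H)

  -- The division makes sense because [e_(N)]X_H is positive for connected H.
  record _≥ₑ_ (G H : ConnectedGraph N) : Set where
    field
      expansionG   : EExpansion N (X (graph G))
      expansionH   : EExpansion N (X (graph H))
      {{nonZeroH}} : ℚ.NonZero (coeff expansionH (N ∷ []))
      ePositive    : EPositive N (Xₑ G H expansionG expansionH)

  -- Subsets of ℰ_N are given by predicates on connected graphs.
  IsChain : Pred (ConnectedGraph N) 0ℓ → Set₁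
  IsChain S = ∀ G H → G ∈ S → H ∈ S → G ≥ₑ H ⊎ H ≥ₑ G

  IsMaximum IsMinimum : Pred (ConnectedGraph N) 0ℓ → ConnectedGraph N → Set₁
  IsMaximum S M = M ∈ S × (∀ G → G ∈ S → M ≥ₑ G)
  IsMinimum S M = M ∈ S × (∀ G → G ∈ S → G ≥ₑ M)

-- The classes in ℰ_N of the lollipop graphs on N vertices.
Lollipops : ∀ N → Pred (ConnectedGraph N) 0ℓ
Lollipops N G = ∃[ m ] ∃[ n ] Σ[ eq ∈ m ℕ.+ n ≡ N ] (1 ≤ m × G ∼ L m n eq)

shift : ∀ {N m n} → 3 ≤ m → m ℕ.+ n ≡ N → (m ℕ.∸ 1) ℕ.+ (n ℕ.+ 1) ≡ N
shift {m = suc m} {n} _ eq =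
  trans (cong (m ℕ.+_) (ℕ.+-comm n 1)) (trans (ℕ.+-suc m n) eq)

{-# OPTIONS --safe #-}
module Submission where

-- Color the tail of L_{m,n} together with vertex m, a path P_{n+1} whose first
-- color is c, and then the remaining clique vertices by m − 1 distinct colors.
-- For L_{m,n} these have to avoid c, for L_{m-1,n+1} only the last of them has to
-- differ from c, and for the disjoint union of K_{m-1} and P_{n+1} there is no
-- condition.  By the symmetry of the clique this gives
--   X_{L_{m,n}} + (m − 2) X_{K_{m-1}} X_{P_{n+1}} = (m − 1) X_{L_{m-1,n+1}}.
-- As the product on the left has no e_(N)-term, X_e(L_{m-1,n+1}, L_{m,n}) is
-- (m − 2)/(m − 1) X_{K_{m-1}} X_{P_{n+1}}, where X_{K_{m-1}} = (m − 1)! e_{m-1},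
-- and the path P_{n+1} = L_{1,n} is e-positive by the same recurrence.

open import Defs
open import Data.Bool.Base using (true; false; if_then_else_)
open import Data.Fin.Base as Fin using (Fin; zero; suc; toℕ; fromℕ; _↑ˡ_; _↑ʳ_)
import Data.Fin.Properties as Fin
open import Data.List.Base as List
  using (List; []; _∷_; map; filter; concatMap; cartesianProductWith; applyUpTo; upTo; allFin)
open import Data.List.Membership.Propositional using () renaming (_∈_ to _∈ˡ_)
open import Data.List.Membership.Propositional.Properties using (∈-filter⁻)
import Data.List.Properties as List
open import Data.List.Relation.Binary.Permutation.Propositional as Perm using (_↭_)
import Data.List.Relation.Binary.Permutation.Propositional.Properties as Perm
import Data.List.Relation.Unary.All as AllL
import Data.List.Relation.Unary.All.Properties as AllL
open import Data.List.Relation.Unary.Any using (here; there)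
open import Data.List.Relation.Unary.Linked using (Linked; linked?; [-])
open import Data.Nat.Base as ℕ using (ℕ; zero; suc; _+_; _∸_; _≤_; z≤n; s≤s; _!)
open import Data.Nat.ListAction using (sum)
open import Data.Nat.ListAction.Properties using (sum-↭)
import Data.Nat.Properties as ℕ
open import Data.Product using (_×_; _,_; proj₁; proj₂)
open import Data.Rational.Base as ℚ using (ℚ; 0ℚ; 1ℚ)
import Data.Rational.Properties as ℚ
open import Data.Rational.Solver using (module +-*-Solver)
open +-*-Solver using (solve; _:=_; _:+_; _:*_; _:-_; :-_; con)
open import Data.Sum.Base using (inj₁; inj₂)
open import Data.Unit.Base using (⊤; tt)
open import Data.Vec.Base as Vec using (Vec; []; _∷_; zipWith; lookup; count; tabulate; updateAt)
import Data.Vec.Properties as Vec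
open import Data.Vec.Relation.Unary.All as All using (All; []; _∷_)
import Data.Vec.Relation.Unary.All.Properties as All
open import Function.Base using (_∘_; id; _$_)
open import Function.Bundles using (_⇔_; mk⇔; Equivalence)
import Function.Properties.Equivalence as Equiv
open import Relation.Binary.Properties.DecTotalOrder ℕ.≤-decTotalOrder using (≥-decTotalOrder)
open import Data.List.Sort.InsertionSort.Base ≥-decTotalOrder using (insert)
open import Data.List.Sort.InsertionSort.Properties ≥-decTotalOrder using (insert-↭; insert-↗)
open import Relation.Binary.PropositionalEquality
open import Relation.Nullary.Decidable
  using (Dec; does; yes; no; ¬?; _×-dec_; _→-dec_; does-⇔; dec-true; dec-false)
open import Relation.Nullary.Negation using (¬_; contradiction)
open ≡-Reasoning
open ConnectedGraph using (graph)
open Graph using (_~_)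

-- The relation `_≥ₑ_` asks for expansions as data, so every lollipop graph receives an explicit
-- coefficient function. It is computed by recursion on the length of the tail: the recurrence
-- expresses L_{s+1,n+1} through L_{s+2,n} and the path L_{1,n}, both with the shorter tail n. The
-- recurrence already holds for m = 2, where the factor m - 2 vanishes and both lollipops are the
-- same path; this lets the recursion reach the path itself. Symmetry enters after a coloring of the
-- path has been fixed: the weight of a coloring of the remaining clique vertices then depends only
-- on how often each color occurs, so all positions in the clique contribute equally, and the number
-- of occurrences of c can be traded for a multiple of the event that c is in the last position.
-- Lollipops further apart are compared by composing single steps. The quotient of the
-- e_(N)-coefficients in a step is 1/(m - 1), and these quotients multiply along the chain.

private variable
  A B : Set
  k r s n : ℕ

-- Indicators of decidable propositions

𝟙 : Dec A → ℚ
𝟙 a? = if does a? then 1ℚ else 0ℚ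

𝟙-yes : (a? : Dec A) → A → 𝟙 a? ≡ 1ℚ
𝟙-yes a? a = cong (if_then 1ℚ else 0ℚ) (dec-true a? a)

𝟙-no : (a? : Dec A) → ¬ A → 𝟙 a? ≡ 0ℚ
𝟙-no a? ¬a = cong (if_then 1ℚ else 0ℚ) (dec-false a? ¬a)

𝟙-cong : A ⇔ B → (a? : Dec A) (b? : Dec B) → 𝟙 a? ≡ 𝟙 b?
𝟙-cong A⇔B a? b? = cong (if_then 1ℚ else 0ℚ) (does-⇔ A⇔B a? b?)

𝟙-× : (a? : Dec A) (b? : Dec B) → 𝟙 (a? ×-dec b?) ≡ 𝟙 a? ℚ.* 𝟙 b?
𝟙-× a? b? with does a?
... | true  = sym (ℚ.*-identityˡ _)
... | false = sym (ℚ.*-zeroˡ (𝟙 b?))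

𝟙≥0 : (a? : Dec A) → 0ℚ ℚ.≤ 𝟙 a?
𝟙≥0 a? with does a?
... | true  = ℚ.nonNegative⁻¹ 1ℚ
... | false = ℚ.≤-refl

-- The tool for rewriting one factor under a condition that another factor enforces.
𝟙-*-cong : (a? : Dec A) {p q : ℚ} → (A → p ≡ q) → 𝟙 a? ℚ.* p ≡ 𝟙 a? ℚ.* q
𝟙-*-cong (yes a) p≡q = cong (1ℚ ℚ.*_) (p≡q a)
𝟙-*-cong (no _) {p} {q} _ = trans (ℚ.*-zeroˡ p) (sym (ℚ.*-zeroˡ q))

-- Finite sums of rationals

∑-cong-∈ : (xs : List A) {f g : A → ℚ} → (∀ x → x ∈ˡ xs → f x ≡ g x) → ∑ xs f ≡ ∑ xs g
∑-cong-∈ []       f≡g = refl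
∑-cong-∈ (x ∷ xs) f≡g =
  cong₂ ℚ._+_ (f≡g x (here refl)) (∑-cong-∈ xs λ y y∈xs → f≡g y (there y∈xs))

∑-cong : (xs : List A) {f g : A → ℚ} → (∀ x → f x ≡ g x) → ∑ xs f ≡ ∑ xs g
∑-cong xs f≡g = ∑-cong-∈ xs λ x _ → f≡g x

∑-zero : (xs : List A) → ∑ xs (λ _ → 0ℚ) ≡ 0ℚ
∑-zero []       = refl
∑-zero (x ∷ xs) = trans (ℚ.+-identityˡ _) (∑-zero xs)

∑-≥0 : (xs : List A) {f : A → ℚ} → (∀ x → x ∈ˡ xs → 0ℚ ℚ.≤ f x) → 0ℚ ℚ.≤ ∑ xs f
∑-≥0 []       f≥0 = ℚ.≤-refl
∑-≥0 (x ∷ xs) f≥0 = ℚ.+-mono-≤ (f≥0 x (here refl)) (∑-≥0 xs λ y y∈xs → f≥0 y (there y∈xs))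

∑-++ : (xs ys : List A) (f : A → ℚ) → ∑ (xs List.++ ys) f ≡ ∑ xs f ℚ.+ ∑ ys f
∑-++ []       ys f = sym (ℚ.+-identityˡ _)
∑-++ (x ∷ xs) ys f = trans (cong (f x ℚ.+_) (∑-++ xs ys f)) (sym (ℚ.+-assoc (f x) _ _))

∑-map : (g : A → B) (xs : List A) (f : B → ℚ) → ∑ (map g xs) f ≡ ∑ xs (f ∘ g)
∑-map g []       f = refl
∑-map g (x ∷ xs) f = cong (f (g x) ℚ.+_) (∑-map g xs f)

∑-concatMap : (g : A → List B) (xs : List A) (f : B → ℚ) →
              ∑ (concatMap g xs) f ≡ ∑ xs λ x → ∑ (g x) f
∑-concatMap g []       f = refl
∑-concatMap g (x ∷ xs) f =
  trans (∑-++ (g x) (concatMap g xs) f) (cong (∑ (g x) f ℚ.+_) (∑-concatMap g xs f))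

∑-cartesianProductWith : {C : Set} (_∙_ : A → B → C) (xs : List A) (ys : List B) (f : C → ℚ) →
                         ∑ (cartesianProductWith _∙_ xs ys) f ≡ ∑ xs λ x → ∑ ys λ y → f (x ∙ y)
∑-cartesianProductWith _∙_ []       ys f = refl
∑-cartesianProductWith _∙_ (x ∷ xs) ys f =
  trans (∑-++ (map (x ∙_) ys) (cartesianProductWith _∙_ xs ys) f)
        (cong₂ ℚ._+_ (∑-map (x ∙_) ys f) (∑-cartesianProductWith _∙_ xs ys f))

∑-filter : {P : A → Set} (P? : ∀ x → Dec (P x)) (xs : List A) (f : A → ℚ) →
           ∑ (filter P? xs) f ≡ ∑ xs λ x → 𝟙 (P? x) ℚ.* f x
∑-filter P? []       f = refl
∑-filter P? (x ∷ xs) f with does (P? x)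
... | true  = cong₂ ℚ._+_ (sym (ℚ.*-identityˡ (f x))) (∑-filter P? xs f)
... | false = trans (∑-filter P? xs f)
                (sym (trans (cong (ℚ._+ _) (ℚ.*-zeroˡ (f x))) (ℚ.+-identityˡ _)))

∑-+ : (xs : List A) (f g : A → ℚ) → ∑ xs (λ x → f x ℚ.+ g x) ≡ ∑ xs f ℚ.+ ∑ xs g
∑-+ []       f g = refl
∑-+ (x ∷ xs) f g = trans (cong (f x ℚ.+ g x ℚ.+_) (∑-+ xs f g))
  (solve 4 (λ a b c d → (a :+ b) :+ (c :+ d) := (a :+ c) :+ (b :+ d)) refl (f x) (g x) _ _)

∑-*ˡ : (q : ℚ) (xs : List A) (f : A → ℚ) → ∑ xs (λ x → q ℚ.* f x) ≡ q ℚ.* ∑ xs f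
∑-*ˡ q []       f = sym (ℚ.*-zeroʳ q)
∑-*ˡ q (x ∷ xs) f = trans (cong (q ℚ.* f x ℚ.+_) (∑-*ˡ q xs f)) (sym (ℚ.*-distribˡ-+ q (f x) _))

∑-*ʳ : (q : ℚ) (xs : List A) (f : A → ℚ) → ∑ xs (λ x → f x ℚ.* q) ≡ ∑ xs f ℚ.* q
∑-*ʳ q xs f =
  trans (∑-cong xs λ x → ℚ.*-comm (f x) q) (trans (∑-*ˡ q xs f) (ℚ.*-comm q _))

∑-swap : (xs : List A) (ys : List B) (f : A → B → ℚ) →
         (∑ xs λ x → ∑ ys λ y → f x y) ≡ ∑ ys λ y → ∑ xs λ x → f x y
∑-swap []       ys f = sym (∑-zero ys)
∑-swap (x ∷ xs) ys f =
  trans (cong (∑ ys (f x) ℚ.+_) (∑-swap xs ys f)) (sym (∑-+ ys (f x) λ y → ∑ xs λ x → f x y))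

∑-applyUpTo : (g : ℕ → A) (n : ℕ) (f : A → ℚ) → ∑ (applyUpTo g n) f ≡ ∑ (upTo n) (f ∘ g)
∑-applyUpTo g zero    f = refl
∑-applyUpTo g (suc n) f = cong (f (g 0) ℚ.+_)
  (trans (∑-applyUpTo (g ∘ suc) n f) (sym (∑-applyUpTo suc n (f ∘ g))))

∑-upTo-suc : (n : ℕ) (f : ℕ → ℚ) → ∑ (upTo (suc n)) f ≡ f 0 ℚ.+ ∑ (upTo n) (f ∘ suc)
∑-upTo-suc n f = cong (f 0 ℚ.+_) (∑-applyUpTo suc n f)

∑-tabulate : (n : ℕ) (g : Fin n → A) (f : A → ℚ) → ∑ (List.tabulate g) f ≡ ∑ (allFin n) (f ∘ g)
∑-tabulate zero    g f = refl
∑-tabulate (suc n) g f = cong (f (g zero) ℚ.+_)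
  (trans (∑-tabulate n (g ∘ suc) f) (sym (∑-tabulate n suc (f ∘ g))))

∑-allFin-suc : (n : ℕ) (f : Fin (suc n) → ℚ) → ∑ (allFin (suc n)) f ≡ f zero ℚ.+ ∑ (allFin n) (f ∘ suc)
∑-allFin-suc n f = cong (f zero ℚ.+_) (∑-tabulate n suc f)

-- Products of series

-- The sum over all b + c ≤ a. This is the shape of a triple product in one variable, whose third
-- exponent is a - b - c.
triangle : ℕ → (ℕ → ℕ → ℚ) → ℚ
triangle a f = ∑ (upTo (suc a)) λ b → ∑ (upTo (suc (a ∸ b))) λ c → f b c

triangle-sucˡ : (a : ℕ) (f : ℕ → ℕ → ℚ) →
  triangle (suc a) f ≡ ∑ (upTo (suc (suc a))) (f 0) ℚ.+ triangle a (f ∘ suc)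
triangle-sucˡ a f = ∑-upTo-suc (suc a) λ b → ∑ (upTo (suc (suc a ∸ b))) (f b)

-- The column c = 0 is spread over all inner sums, so it is detached by induction along the rows:
-- remove the row b = 0, detach the column from the smaller triangle, and put the row back.
triangle-sucʳ : (a : ℕ) (f : ℕ → ℕ → ℚ) →
  triangle (suc a) f ≡ ∑ (upTo (suc (suc a))) (λ b → f b 0) ℚ.+ triangle a (λ b c → f b (suc c))
triangle-sucʳ zero f =
  solve 3 (λ x y z → (x :+ (y :+ con 0ℚ)) :+ ((z :+ con 0ℚ) :+ con 0ℚ)
                  := (x :+ (z :+ con 0ℚ)) :+ ((y :+ con 0ℚ) :+ con 0ℚ)) refl (f 0 0) (f 0 1) (f 1 0)
triangle-sucʳ (suc a) f = begin
  triangle (2 + a) f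
    ≡⟨ triangle-sucˡ (suc a) f ⟩
  ∑ (upTo (3 + a)) (f 0) ℚ.+ triangle (suc a) (f ∘ suc)
    ≡⟨ cong₂ ℚ._+_ (∑-upTo-suc (2 + a) (f 0)) (triangle-sucʳ a (f ∘ suc)) ⟩
  (f 0 0 ℚ.+ ∑ (upTo (2 + a)) (f 0 ∘ suc))
    ℚ.+ (∑ (upTo (2 + a)) (λ b → f (suc b) 0) ℚ.+ triangle a (λ b c → f (suc b) (suc c)))
    ≡⟨ solve 4 (λ x y z t → (x :+ y) :+ (z :+ t) := (x :+ z) :+ (y :+ t)) refl (f 0 0) _ _ _ ⟩
  (f 0 0 ℚ.+ ∑ (upTo (2 + a)) (λ b → f (suc b) 0))
    ℚ.+ (∑ (upTo (2 + a)) (f 0 ∘ suc) ℚ.+ triangle a (λ b c → f (suc b) (suc c)))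
    ≡⟨ cong₂ ℚ._+_ (∑-upTo-suc (2 + a) λ b → f b 0) (triangle-sucˡ a λ b c → f b (suc c)) ⟨
  ∑ (upTo (3 + a)) (λ b → f b 0) ℚ.+ triangle (suc a) (λ b c → f b (suc c)) ∎

-- A row of one triangle is a column of the other; peeling both off leaves the claim for a smaller
-- triangle.
triangle-swap : (a : ℕ) (f : ℕ → ℕ → ℚ) → triangle a f ≡ triangle a λ b c → f c b
triangle-swap zero    f = refl
triangle-swap (suc a) f = begin
  triangle (suc a) f
    ≡⟨ triangle-sucˡ a f ⟩
  ∑ (upTo (suc (suc a))) (f 0) ℚ.+ triangle a (f ∘ suc)
    ≡⟨ cong (∑ (upTo (suc (suc a))) (f 0) ℚ.+_) (triangle-swap a (f ∘ suc)) ⟩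
  ∑ (upTo (suc (suc a))) (f 0) ℚ.+ triangle a (λ b c → f (suc c) b)
    ≡⟨ triangle-sucʳ a (λ b c → f c b) ⟨
  triangle (suc a) (λ b c → f c b) ∎

-- The product `_·_` at a fixed number of variables. Fixing the first exponent of a series gives a
-- function on `Vec ℕ k` that is no longer a `Series`, and inductions on the number of variables
-- need products of such functions.
conv : (Vec ℕ k → ℚ) → (Vec ℕ k → ℚ) → Vec ℕ k → ℚ
conv f g α = ∑ (below α) λ β → f β ℚ.* g (zipWith _∸_ α β)

conv-∷ : (f g : Vec ℕ (suc k) → ℚ) (a : ℕ) (α : Vec ℕ k) →
         conv f g (a ∷ α) ≡ ∑ (upTo (suc a)) λ b → conv (f ∘ (b ∷_)) (g ∘ ((a ∸ b) ∷_)) α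
conv-∷ f g a α = ∑-cartesianProductWith _∷_ (upTo (suc a)) (below α) _

conv-cong : {f f′ g g′ : Vec ℕ k → ℚ} → f ≗ f′ → g ≗ g′ → conv f g ≗ conv f′ g′
conv-cong f≗f′ g≗g′ α = ∑-cong (below α) λ β → cong₂ ℚ._*_ (f≗f′ β) (g≗g′ _)

conv-∑ʳ : (f : Vec ℕ k → ℚ) (xs : List A) (g : A → Vec ℕ k → ℚ) (α : Vec ℕ k) →
          conv f (λ γ → ∑ xs λ x → g x γ) α ≡ ∑ xs λ x → conv f (g x) α
conv-∑ʳ f xs g α =
  trans (∑-cong (below α) λ β → sym (∑-*ˡ (f β) xs λ x → g x (zipWith _∸_ α β)))
        (∑-swap (below α) xs λ β x → f β ℚ.* g x (zipWith _∸_ α β))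

conv-*ʳ : (q : ℚ) (f g : Vec ℕ k → ℚ) (α : Vec ℕ k) →
          conv f (λ γ → q ℚ.* g γ) α ≡ q ℚ.* conv f g α
conv-*ʳ q f g α =
  trans (∑-cong (below α) λ β → solve 3 (λ x y z → x :* (y :* z) := y :* (x :* z)) refl (f β) q _)
        (∑-*ˡ q (below α) λ β → f β ℚ.* g (zipWith _∸_ α β))

conv-*ˡ : (q : ℚ) (f g : Vec ℕ k → ℚ) (α : Vec ℕ k) →
          conv (λ γ → q ℚ.* f γ) g α ≡ q ℚ.* conv f g α
conv-*ˡ q f g α =
  trans (∑-cong (below α) λ β → ℚ.*-assoc q (f β) _)
        (∑-*ˡ q (below α) λ β → f β ℚ.* g (zipWith _∸_ α β))

conv-∑ˡ : (xs : List A) (f : A → Vec ℕ k → ℚ) (g : Vec ℕ k → ℚ) (α : Vec ℕ k) →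
          conv (λ γ → ∑ xs λ x → f x γ) g α ≡ ∑ xs λ x → conv (f x) g α
conv-∑ˡ xs f g α =
  trans (∑-cong (below α) λ β → sym (∑-*ʳ (g (zipWith _∸_ α β)) xs λ x → f x β))
        (∑-swap (below α) xs λ β x → f x β ℚ.* g (zipWith _∸_ α β))

-- Induction on the number of variables: in the first variable both sides are sums over a triangle
-- with the roles of b and c exchanged. This is the form in which two neighboring factors of `e` are
-- transposed.
conv-leftComm : (f g h : Vec ℕ k → ℚ) → conv f (conv g h) ≗ conv g (conv f h)
conv-leftComm f g h [] =
  solve 3 (λ x y z → x :* (y :* z :+ con 0ℚ) :+ con 0ℚ := y :* (x :* z :+ con 0ℚ) :+ con 0ℚ)
    refl (f []) (g []) (h [])
conv-leftComm {suc k} f g h (a ∷ α) = begin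
  conv f (conv g h) (a ∷ α)
    ≡⟨ expand f g ⟩
  triangle a (λ b c → conv (f ∘ (b ∷_)) (conv (g ∘ (c ∷_)) (h ∘ ((a ∸ b ∸ c) ∷_))) α)
    ≡⟨ triangle-swap a (λ b c → conv (f ∘ (b ∷_)) (conv (g ∘ (c ∷_)) (h ∘ ((a ∸ b ∸ c) ∷_))) α) ⟩
  triangle a (λ b c → conv (f ∘ (c ∷_)) (conv (g ∘ (b ∷_)) (h ∘ ((a ∸ c ∸ b) ∷_))) α)
    ≡⟨ ∑-cong (upTo (suc a)) (λ b → ∑-cong (upTo (suc (a ∸ b))) λ c →
         trans (conv-leftComm (f ∘ (c ∷_)) (g ∘ (b ∷_)) (h ∘ ((a ∸ c ∸ b) ∷_)) α)
               (cong (λ x → conv (g ∘ (b ∷_)) (conv (f ∘ (c ∷_)) (h ∘ (x ∷_))) α)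
                     (∸-comm a c b))) ⟩
  triangle a (λ b c → conv (g ∘ (b ∷_)) (conv (f ∘ (c ∷_)) (h ∘ ((a ∸ b ∸ c) ∷_))) α)
    ≡⟨ expand g f ⟨
  conv g (conv f h) (a ∷ α) ∎
  where
  ∸-comm : ∀ a b c → a ∸ b ∸ c ≡ a ∸ c ∸ b
  ∸-comm a b c = trans (ℕ.∸-+-assoc a b c)
                (trans (cong (a ∸_) (ℕ.+-comm b c)) (sym (ℕ.∸-+-assoc a c b)))

  expand : (f g : Vec ℕ (suc k) → ℚ) → conv f (conv g h) (a ∷ α) ≡
           triangle a (λ b c → conv (f ∘ (b ∷_)) (conv (g ∘ (c ∷_)) (h ∘ ((a ∸ b ∸ c) ∷_))) α)
  expand f g = trans (conv-∷ f (conv g h) a α) (∑-cong (upTo (suc a)) λ b →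
    trans (conv-cong {f = f ∘ (b ∷_)} (λ _ → refl) (conv-∷ g h (a ∸ b)) α)
          (conv-∑ʳ (f ∘ (b ∷_)) (upTo (suc (a ∸ b)))
            (λ c → conv (g ∘ (c ∷_)) (h ∘ ((a ∸ b ∸ c) ∷_))) α))

-- The coefficient function of the monomial with exponent vector `β`; `monomialCoeff κ` is
-- `δ (content κ)` by computation.
δ : Vec ℕ k → Vec ℕ k → ℚ
δ β α = 𝟙 (Vec.≡-dec ℕ._≟_ β α)

δ-∷ : (b a : ℕ) (β α : Vec ℕ k) → δ (b ∷ β) (a ∷ α) ≡ 𝟙 (b ℕ.≟ a) ℚ.* δ β α
δ-∷ b a β α = 𝟙-× (b ℕ.≟ a) (Vec.≡-dec ℕ._≟_ β α)

-- The case of a single variable of `conv-δ-δ`: x^b x^c = x^(b+c).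
∑-𝟙-∸ : (b c a : ℕ) →
  ∑ (upTo (suc a)) (λ x → 𝟙 (b ℕ.≟ x) ℚ.* 𝟙 (c ℕ.≟ a ∸ x)) ≡ 𝟙 (b + c ℕ.≟ a)
∑-𝟙-∸ zero c a = begin
  ∑ (upTo (suc a)) (λ x → 𝟙 (0 ℕ.≟ x) ℚ.* 𝟙 (c ℕ.≟ a ∸ x))
    ≡⟨ ∑-upTo-suc a (λ x → 𝟙 (0 ℕ.≟ x) ℚ.* 𝟙 (c ℕ.≟ a ∸ x)) ⟩
  1ℚ ℚ.* 𝟙 (c ℕ.≟ a) ℚ.+ ∑ (upTo a) (λ x → 0ℚ ℚ.* 𝟙 (c ℕ.≟ a ∸ suc x))
    ≡⟨ cong₂ ℚ._+_ (ℚ.*-identityˡ (𝟙 (c ℕ.≟ a)))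
         (trans (∑-cong (upTo a) λ x → ℚ.*-zeroˡ (𝟙 (c ℕ.≟ a ∸ suc x))) (∑-zero (upTo a))) ⟩
  𝟙 (c ℕ.≟ a) ℚ.+ 0ℚ
    ≡⟨ ℚ.+-identityʳ (𝟙 (c ℕ.≟ a)) ⟩
  𝟙 (c ℕ.≟ a) ∎
∑-𝟙-∸ (suc b) c zero    = cong (ℚ._+ 0ℚ) (ℚ.*-zeroˡ (𝟙 (c ℕ.≟ 0)))
∑-𝟙-∸ (suc b) c (suc a) = begin
  ∑ (upTo (suc (suc a))) (λ x → 𝟙 (suc b ℕ.≟ x) ℚ.* 𝟙 (c ℕ.≟ suc a ∸ x))
    ≡⟨ ∑-upTo-suc (suc a) (λ x → 𝟙 (suc b ℕ.≟ x) ℚ.* 𝟙 (c ℕ.≟ suc a ∸ x)) ⟩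
  0ℚ ℚ.* 𝟙 (c ℕ.≟ suc a) ℚ.+ ∑ (upTo (suc a)) (λ x → 𝟙 (b ℕ.≟ x) ℚ.* 𝟙 (c ℕ.≟ a ∸ x))
    ≡⟨ cong₂ ℚ._+_ (ℚ.*-zeroˡ (𝟙 (c ℕ.≟ suc a))) (∑-𝟙-∸ b c a) ⟩
  0ℚ ℚ.+ 𝟙 (b + c ℕ.≟ a)
    ≡⟨ ℚ.+-identityˡ (𝟙 (b + c ℕ.≟ a)) ⟩
  𝟙 (b + c ℕ.≟ a) ∎

conv-δ-δ : (β γ : Vec ℕ k) → conv (δ β) (δ γ) ≗ δ (zipWith _+_ β γ)
conv-δ-δ []      []      []      = refl
conv-δ-δ (b ∷ β) (c ∷ γ) (a ∷ α) = begin
  conv (δ (b ∷ β)) (δ (c ∷ γ)) (a ∷ α)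
    ≡⟨ conv-∷ (δ (b ∷ β)) (δ (c ∷ γ)) a α ⟩
  ∑ (upTo (suc a)) (λ x → conv (δ (b ∷ β) ∘ (x ∷_)) (δ (c ∷ γ) ∘ ((a ∸ x) ∷_)) α)
    ≡⟨ ∑-cong (upTo (suc a)) split ⟩
  ∑ (upTo (suc a)) (λ x → 𝟙 (b ℕ.≟ x) ℚ.* 𝟙 (c ℕ.≟ a ∸ x) ℚ.* conv (δ β) (δ γ) α)
    ≡⟨ ∑-*ʳ (conv (δ β) (δ γ) α) (upTo (suc a)) (λ x → 𝟙 (b ℕ.≟ x) ℚ.* 𝟙 (c ℕ.≟ a ∸ x)) ⟩
  ∑ (upTo (suc a)) (λ x → 𝟙 (b ℕ.≟ x) ℚ.* 𝟙 (c ℕ.≟ a ∸ x)) ℚ.* conv (δ β) (δ γ) α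
    ≡⟨ cong₂ ℚ._*_ (∑-𝟙-∸ b c a) (conv-δ-δ β γ α) ⟩
  𝟙 (b + c ℕ.≟ a) ℚ.* δ (zipWith _+_ β γ) α
    ≡⟨ δ-∷ (b + c) a (zipWith _+_ β γ) α ⟨
  δ (zipWith _+_ (b ∷ β) (c ∷ γ)) (a ∷ α) ∎
  where
  split : ∀ x → conv (δ (b ∷ β) ∘ (x ∷_)) (δ (c ∷ γ) ∘ ((a ∸ x) ∷_)) α ≡
                𝟙 (b ℕ.≟ x) ℚ.* 𝟙 (c ℕ.≟ a ∸ x) ℚ.* conv (δ β) (δ γ) α
  split x = begin
    conv (δ (b ∷ β) ∘ (x ∷_)) (δ (c ∷ γ) ∘ ((a ∸ x) ∷_)) α
      ≡⟨ conv-cong (δ-∷ b x β) (δ-∷ c (a ∸ x) γ) α ⟩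
    conv (λ η → 𝟙 (b ℕ.≟ x) ℚ.* δ β η) (λ η → 𝟙 (c ℕ.≟ a ∸ x) ℚ.* δ γ η) α
      ≡⟨ conv-*ˡ (𝟙 (b ℕ.≟ x)) (δ β) (λ η → 𝟙 (c ℕ.≟ a ∸ x) ℚ.* δ γ η) α ⟩
    𝟙 (b ℕ.≟ x) ℚ.* conv (δ β) (λ η → 𝟙 (c ℕ.≟ a ∸ x) ℚ.* δ γ η) α
      ≡⟨ cong (𝟙 (b ℕ.≟ x) ℚ.*_) (conv-*ʳ (𝟙 (c ℕ.≟ a ∸ x)) (δ β) (δ γ) α) ⟩
    𝟙 (b ℕ.≟ x) ℚ.* (𝟙 (c ℕ.≟ a ∸ x) ℚ.* conv (δ β) (δ γ) α)
      ≡⟨ ℚ.*-assoc (𝟙 (b ℕ.≟ x)) (𝟙 (c ℕ.≟ a ∸ x)) _ ⟨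
    𝟙 (b ℕ.≟ x) ℚ.* 𝟙 (c ℕ.≟ a ∸ x) ℚ.* conv (δ β) (δ γ) α ∎

-- The series e₀ is 1. As `e` ends every product with `elem 0`, this identifies `e (r ∷ [])` with
-- `elem r`.
conv-elem-0ʳ : (f : Vec ℕ k → ℚ) → conv f (elem 0 k) ≗ f
conv-elem-0ʳ f []      = trans (ℚ.+-identityʳ _) (ℚ.*-identityʳ (f []))
conv-elem-0ʳ {suc k} f (a ∷ α) = begin
  conv f (elem 0 (suc k)) (a ∷ α)
    ≡⟨ conv-∷ f (elem 0 (suc k)) a α ⟩
  ∑ (upTo (suc a)) (λ x → conv (f ∘ (x ∷_)) (elem 0 (suc k) ∘ ((a ∸ x) ∷_)) α)
    ≡⟨ ∑-cong (upTo (suc a)) (λ x → begin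
         conv (f ∘ (x ∷_)) (elem 0 (suc k) ∘ ((a ∸ x) ∷_)) α
           ≡⟨ conv-cong {f = f ∘ (x ∷_)} (λ _ → refl) (elem-0-∷ (a ∸ x)) α ⟩
         conv (f ∘ (x ∷_)) (λ γ → 𝟙 (a ∸ x ℕ.≟ 0) ℚ.* elem 0 k γ) α
           ≡⟨ conv-*ʳ (𝟙 (a ∸ x ℕ.≟ 0)) (f ∘ (x ∷_)) (elem 0 k) α ⟩
         𝟙 (a ∸ x ℕ.≟ 0) ℚ.* conv (f ∘ (x ∷_)) (elem 0 k) α
           ≡⟨ cong (𝟙 (a ∸ x ℕ.≟ 0) ℚ.*_) (conv-elem-0ʳ (f ∘ (x ∷_)) α) ⟩
         𝟙 (a ∸ x ℕ.≟ 0) ℚ.* f (x ∷ α) ∎) ⟩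
  ∑ (upTo (suc a)) (λ x → 𝟙 (a ∸ x ℕ.≟ 0) ℚ.* f (x ∷ α))
    ≡⟨ select a (λ x → f (x ∷ α)) ⟩
  f (a ∷ α) ∎
  where
  elem-0-∷ : ∀ {k} (c : ℕ) (γ : Vec ℕ k) → elem 0 (suc k) (c ∷ γ) ≡ 𝟙 (c ℕ.≟ 0) ℚ.* elem 0 k γ
  elem-0-∷ {k} zero    γ = sym (ℚ.*-identityˡ (elem 0 k γ))
  elem-0-∷ {k} (suc c) γ = trans
    (𝟙-no (All.all? (ℕ._≤? 1) (suc c ∷ γ) ×-dec (Vec.sum (suc c ∷ γ) ℕ.≟ 0)) λ ())
    (sym (ℚ.*-zeroˡ (elem 0 k γ)))

  -- In the range x ≤ a the truncated difference `a ∸ x` vanishes only at the last index x = a.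
  select : (a : ℕ) (g : ℕ → ℚ) → ∑ (upTo (suc a)) (λ x → 𝟙 (a ∸ x ℕ.≟ 0) ℚ.* g x) ≡ g a
  select zero    g = trans (ℚ.+-identityʳ _) (ℚ.*-identityˡ (g 0))
  select (suc a) g = begin
    ∑ (upTo (suc (suc a))) (λ x → 𝟙 (suc a ∸ x ℕ.≟ 0) ℚ.* g x)
      ≡⟨ ∑-upTo-suc (suc a) (λ x → 𝟙 (suc a ∸ x ℕ.≟ 0) ℚ.* g x) ⟩
    0ℚ ℚ.* g 0 ℚ.+ ∑ (upTo (suc a)) (λ x → 𝟙 (a ∸ x ℕ.≟ 0) ℚ.* g (suc x))
      ≡⟨ cong₂ ℚ._+_ (ℚ.*-zeroˡ (g 0)) (select a (g ∘ suc)) ⟩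
    0ℚ ℚ.+ g (suc a)
      ≡⟨ ℚ.+-identityˡ (g (suc a)) ⟩
    g (suc a) ∎

-- Contents of words

∑-colorings-suc : (r : ℕ) (f : Vec (Fin k) (suc r) → ℚ) →
  ∑ (colorings (suc r) k) f ≡ ∑ (allFin k) λ c → ∑ (colorings r k) λ u → f (c ∷ u)
∑-colorings-suc {k} r = ∑-cartesianProductWith _∷_ (allFin k) (colorings r k)

∑-colorings-++ : (r s : ℕ) (f : Vec (Fin k) (r + s) → ℚ) →
  ∑ (colorings (r + s) k) f ≡ ∑ (colorings r k) λ u → ∑ (colorings s k) λ w → f (u Vec.++ w)
∑-colorings-++     zero    s f = sym (ℚ.+-identityʳ _)
∑-colorings-++ {k} (suc r) s f = begin
  ∑ (colorings (suc r + s) k) f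
    ≡⟨ ∑-colorings-suc (r + s) f ⟩
  ∑ (allFin k) (λ c → ∑ (colorings (r + s) k) λ κ → f (c ∷ κ))
    ≡⟨ ∑-cong (allFin k) (λ c → ∑-colorings-++ r s (f ∘ (c ∷_))) ⟩
  ∑ (allFin k) (λ c → ∑ (colorings r k) λ u → ∑ (colorings s k) λ w → f (c ∷ u Vec.++ w))
    ≡⟨ ∑-colorings-suc r (λ u → ∑ (colorings s k) λ w → f (u Vec.++ w)) ⟨
  ∑ (colorings (suc r) k) (λ u → ∑ (colorings s k) λ w → f (u Vec.++ w)) ∎

occ : Fin k → Vec (Fin k) r → ℕ
occ c = count (c Fin.≟_)

occ-++ : (c : Fin k) (u : Vec (Fin k) r) (w : Vec (Fin k) s) → occ c (u Vec.++ w) ≡ occ c u + occ c w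
occ-++ c []      w = refl
occ-++ c (a ∷ u) w with does (c Fin.≟ a)
... | true  = cong suc (occ-++ c u w)
... | false = occ-++ c u w

content-++ : (u : Vec (Fin k) r) (w : Vec (Fin k) s) →
             content (u Vec.++ w) ≡ zipWith _+_ (content u) (content w)
content-++ u w = trans (Vec.tabulate-cong λ c → occ-++ c u w) (sym (zipWith-tabulate _ _))
  where
  zipWith-tabulate : ∀ {k} (f g : Fin k → ℕ) →
    zipWith _+_ (tabulate f) (tabulate g) ≡ tabulate λ c → f c + g c
  zipWith-tabulate {zero}  f g = refl
  zipWith-tabulate {suc k} f g = cong ((f zero + g zero) ∷_) (zipWith-tabulate (f ∘ suc) (g ∘ suc))

content-∷ : (c : Fin k) (u : Vec (Fin k) r) → content (c ∷ u) ≡ updateAt (content u) c suc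
content-∷ c u = sym (updateAt-tabulate c λ d → occ d u)
  where
  updateAt-tabulate : ∀ {k} (c : Fin k) (f : Fin k → ℕ) →
    updateAt (tabulate f) c suc ≡ tabulate λ d → (if does (d Fin.≟ c) then suc else id) $ f d
  updateAt-tabulate zero    f = refl
  updateAt-tabulate (suc c) f = cong (f zero ∷_) (updateAt-tabulate c (f ∘ suc))

-- Defined in unary, so that `ι (suc n)` unfolds to `1ℚ ℚ.+ ι n` and the ring solver can treat `ι n`
-- as a variable.
ι : ℕ → ℚ
ι zero    = 0ℚ
ι (suc n) = 1ℚ ℚ.+ ι n

ι-+ : ∀ m n → ι (m + n) ≡ ι m ℚ.+ ι n
ι-+ zero    n = sym (ℚ.+-identityˡ (ι n))
ι-+ (suc m) n = trans (cong (1ℚ ℚ.+_) (ι-+ m n)) (sym (ℚ.+-assoc 1ℚ (ι m) (ι n)))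

ι-* : ∀ m n → ι (m ℕ.* n) ≡ ι m ℚ.* ι n
ι-* zero    n = sym (ℚ.*-zeroˡ (ι n))
ι-* (suc m) n = begin
  ι (n + m ℕ.* n)         ≡⟨ ι-+ n (m ℕ.* n) ⟩
  ι n ℚ.+ ι (m ℕ.* n)     ≡⟨ cong (ι n ℚ.+_) (ι-* m n) ⟩
  ι n ℚ.+ ι m ℚ.* ι n     ≡⟨ solve 2 (λ x y → y :+ x :* y := (con 1ℚ :+ x) :* y) refl (ι m) (ι n) ⟩
  (1ℚ ℚ.+ ι m) ℚ.* ι n    ∎

ι-occ-∷ : (c a : Fin k) (u : Vec (Fin k) r) → ι (occ c (a ∷ u)) ≡ 𝟙 (c Fin.≟ a) ℚ.+ ι (occ c u)
ι-occ-∷ c a u with does (c Fin.≟ a)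
... | true  = refl
... | false = sym (ℚ.+-identityˡ _)

-- Sums over words of weights depending only on the content

-- Invariance under permuting the letters, stated through letter counts so that no permutations have
-- to be handled.
Symmetric : (Vec (Fin k) r → ℚ) → Set
Symmetric φ = ∀ u v → (∀ c → occ c u ≡ occ c v) → φ u ≡ φ v

symmetric-∷ : {φ : Vec (Fin k) (suc r) → ℚ} → Symmetric φ → ∀ a → Symmetric (φ ∘ (a ∷_))
symmetric-∷ φ-sym a u v eq =
  φ-sym (a ∷ u) (a ∷ v) λ c → cong (if does (c Fin.≟ a) then suc else id) (eq c)

occ-swap : (a b : Fin k) (u : Vec (Fin k) r) → ∀ c → occ c (a ∷ b ∷ u) ≡ occ c (b ∷ a ∷ u)
occ-swap a b u c with does (c Fin.≟ a) | does (c Fin.≟ b)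
... | true  | true  = refl
... | true  | false = refl
... | false | true  = refl
... | false | false = refl

-- The marked position travels to the end by adjacent transpositions: exchanging the sums over the
-- first two letters moves it from position one to two, and the induction on the tail does the rest.
∑-first≡∑-last : (c : Fin k) (φ : Vec (Fin k) (suc r) → ℚ) → Symmetric φ →
  ∑ (colorings (suc r) k) (λ u → φ u ℚ.* 𝟙 (c Fin.≟ lookup u zero)) ≡
  ∑ (colorings (suc r) k) (λ u → φ u ℚ.* 𝟙 (c Fin.≟ lookup u (fromℕ r)))
∑-first≡∑-last {k} {zero}  c φ φ-sym = refl
∑-first≡∑-last {k} {suc r} c φ φ-sym = begin
  ∑ (colorings (2 + r) k) (λ u → φ u ℚ.* 𝟙 (c Fin.≟ lookup u zero))
    ≡⟨ trans (∑-colorings-suc (suc r) (λ u → φ u ℚ.* 𝟙 (c Fin.≟ lookup u zero)))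
             (∑-cong (allFin k) λ a → ∑-colorings-suc r λ u → φ (a ∷ u) ℚ.* 𝟙 (c Fin.≟ a)) ⟩
  ∑ (allFin k) (λ a → ∑ (allFin k) λ b → ∑ (colorings r k) λ u → φ (a ∷ b ∷ u) ℚ.* 𝟙 (c Fin.≟ a))
    ≡⟨ ∑-swap (allFin k) (allFin k)
         (λ a b → ∑ (colorings r k) λ u → φ (a ∷ b ∷ u) ℚ.* 𝟙 (c Fin.≟ a)) ⟩
  ∑ (allFin k) (λ b → ∑ (allFin k) λ a → ∑ (colorings r k) λ u → φ (a ∷ b ∷ u) ℚ.* 𝟙 (c Fin.≟ a))
    ≡⟨ ∑-cong (allFin k) (λ b → ∑-cong (allFin k) λ a → ∑-cong (colorings r k) λ u →
         cong (ℚ._* 𝟙 (c Fin.≟ a)) (φ-sym (a ∷ b ∷ u) (b ∷ a ∷ u) (occ-swap a b u))) ⟩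
  ∑ (allFin k) (λ b → ∑ (allFin k) λ a → ∑ (colorings r k) λ u → φ (b ∷ a ∷ u) ℚ.* 𝟙 (c Fin.≟ a))
    ≡⟨ ∑-cong (allFin k) (λ b → ∑-colorings-suc r λ v → φ (b ∷ v) ℚ.* 𝟙 (c Fin.≟ lookup v zero)) ⟨
  ∑ (allFin k) (λ b → ∑ (colorings (suc r) k) λ v → φ (b ∷ v) ℚ.* 𝟙 (c Fin.≟ lookup v zero))
    ≡⟨ ∑-cong (allFin k) (λ b → ∑-first≡∑-last c (φ ∘ (b ∷_)) (symmetric-∷ φ-sym b)) ⟩
  ∑ (allFin k) (λ b → ∑ (colorings (suc r) k) λ v → φ (b ∷ v) ℚ.* 𝟙 (c Fin.≟ lookup v (fromℕ r)))
    ≡⟨ ∑-colorings-suc (suc r) (λ u → φ u ℚ.* 𝟙 (c Fin.≟ lookup u (fromℕ (suc r)))) ⟨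
  ∑ (colorings (2 + r) k) (λ u → φ u ℚ.* 𝟙 (c Fin.≟ lookup u (fromℕ (suc r)))) ∎

-- The number `occ c u` is a sum of indicators over the positions of `u`, and by symmetry each
-- position contributes as much as the last one.
∑-occ : (c : Fin k) (φ : Vec (Fin k) (suc r) → ℚ) → Symmetric φ →
  ∑ (colorings (suc r) k) (λ u → φ u ℚ.* ι (occ c u)) ≡
  ι (suc r) ℚ.* ∑ (colorings (suc r) k) (λ u → φ u ℚ.* 𝟙 (c Fin.≟ lookup u (fromℕ r)))
∑-occ {k} {zero}  c φ φ-sym = trans
  (∑-cong (colorings 1 k) λ { (a ∷ []) →
    cong (φ (a ∷ []) ℚ.*_) (trans (ι-occ-∷ c a []) (ℚ.+-identityʳ (𝟙 (c Fin.≟ a)))) })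
  (sym (ℚ.*-identityˡ _))
∑-occ {k} {suc r} c φ φ-sym = begin
  ∑ (colorings (2 + r) k) (λ u → φ u ℚ.* ι (occ c u))
    ≡⟨ ∑-cong (colorings (2 + r) k) (λ { (a ∷ v) →
         trans (cong (φ (a ∷ v) ℚ.*_) (ι-occ-∷ c a v)) (ℚ.*-distribˡ-+ (φ (a ∷ v)) _ _) }) ⟩
  ∑ (colorings (2 + r) k) (λ u → first u ℚ.+ rest u)
    ≡⟨ ∑-+ (colorings (2 + r) k) first rest ⟩
  ∑ (colorings (2 + r) k) first ℚ.+ ∑ (colorings (2 + r) k) rest
    ≡⟨ cong₂ ℚ._+_ (∑-first≡∑-last c φ φ-sym) (begin
         ∑ (colorings (2 + r) k) rest
           ≡⟨ ∑-colorings-suc (suc r) rest ⟩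
         ∑ (allFin k) (λ a → ∑ (colorings (suc r) k) λ v → φ (a ∷ v) ℚ.* ι (occ c v))
           ≡⟨ ∑-cong (allFin k) (λ a → ∑-occ c (φ ∘ (a ∷_)) (symmetric-∷ φ-sym a)) ⟩
         ∑ (allFin k) (λ a → ι (suc r) ℚ.* ∑ (colorings (suc r) k) λ v → last (a ∷ v))
           ≡⟨ ∑-*ˡ (ι (suc r)) (allFin k) (λ a → ∑ (colorings (suc r) k) λ v → last (a ∷ v)) ⟩
         ι (suc r) ℚ.* ∑ (allFin k) (λ a → ∑ (colorings (suc r) k) λ v → last (a ∷ v))
           ≡⟨ cong (ι (suc r) ℚ.*_) (∑-colorings-suc (suc r) last) ⟨
         ι (suc r) ℚ.* ∑ (colorings (2 + r) k) last ∎) ⟩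
  ∑ (colorings (2 + r) k) last ℚ.+ ι (suc r) ℚ.* ∑ (colorings (2 + r) k) last
    ≡⟨ solve 2 (λ x y → y :+ x :* y := (con 1ℚ :+ x) :* y) refl (ι (suc r)) _ ⟩
  ι (2 + r) ℚ.* ∑ (colorings (2 + r) k) last ∎
  where
  first last rest : Vec (Fin k) (2 + r) → ℚ
  first u = φ u ℚ.* 𝟙 (c Fin.≟ lookup u zero)
  last  u = φ u ℚ.* 𝟙 (c Fin.≟ lookup u (fromℕ (suc r)))
  rest  u = φ u ℚ.* ι (occ c (Vec.tail u))

-- The chromatic symmetric function of the complete graph

≢⇒occ≡0 : (c : Fin k) (u : Vec (Fin k) r) → (∀ i → lookup u i ≢ c) → occ c u ≡ 0
≢⇒occ≡0 c []      u≢c = refl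
≢⇒occ≡0 c (a ∷ u) u≢c with c Fin.≟ a
... | yes c≡a = contradiction (sym c≡a) (u≢c zero)
... | no  _   = ≢⇒occ≡0 c u (u≢c ∘ suc)

occ≤1-tail : (c a : Fin k) (u : Vec (Fin k) r) → occ c (a ∷ u) ≤ 1 → occ c u ≤ 1
occ≤1-tail c a u occ≤1 with does (c Fin.≟ a)
... | true  = ℕ.≤-trans (ℕ.n≤1+n _) occ≤1
... | false = occ≤1

occ-head : (c : Fin k) (u : Vec (Fin k) r) → occ c (c ∷ u) ≡ suc (occ c u)
occ-head c u with c Fin.≟ c
... | yes _   = refl
... | no  c≢c = contradiction refl c≢c

occ≡0⇒≢ : (c : Fin k) (u : Vec (Fin k) r) → occ c u ≡ 0 → ∀ i → lookup u i ≢ c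
occ≡0⇒≢ c (a ∷ u) occ≡0 zero    refl = contradiction (trans (sym (occ-head c u)) occ≡0) λ ()
occ≡0⇒≢ c (a ∷ u) occ≡0 (suc i) eq with does (c Fin.≟ a)
... | false = occ≡0⇒≢ c u occ≡0 i eq

Distinct : Vec (Fin k) r → Set
Distinct {r = r} = Proper (graph (K r))

distinct? : (u : Vec (Fin k) r) → Dec (Distinct u)
distinct? {r = r} = proper? (graph (K r))

distinct⇒occ≤1 : (u : Vec (Fin k) r) → Distinct u → ∀ c → occ c u ≤ 1
distinct⇒occ≤1 []      distinct c = z≤n
distinct⇒occ≤1 (a ∷ u) distinct c with c Fin.≟ a
... | yes refl = ℕ.≤-reflexive (cong suc
                   (≢⇒occ≡0 c u λ i → distinct (suc i) zero λ ()))
... | no  _    = distinct⇒occ≤1 u (λ i j i≢j → distinct (suc i) (suc j) (i≢j ∘ Fin.suc-injective)) c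

occ≤1⇒distinct : (u : Vec (Fin k) r) → (∀ c → occ c u ≤ 1) → Distinct u
occ≤1⇒distinct (a ∷ u) occ≤1 zero    zero    i≢j = contradiction refl i≢j
occ≤1⇒distinct (a ∷ u) occ≤1 zero    (suc j) i≢j = ≢-sym
  (occ≡0⇒≢ a u (ℕ.n≤0⇒n≡0 (ℕ.s≤s⁻¹ (subst (_≤ 1) (occ-head a u) (occ≤1 a)))) j)
occ≤1⇒distinct (a ∷ u) occ≤1 (suc i) zero    i≢j =
  occ≡0⇒≢ a u (ℕ.n≤0⇒n≡0 (ℕ.s≤s⁻¹ (subst (_≤ 1) (occ-head a u) (occ≤1 a)))) i
occ≤1⇒distinct (a ∷ u) occ≤1 (suc i) (suc j) i≢j =
  occ≤1⇒distinct u (λ c → occ≤1-tail c a u (occ≤1 c)) i j (i≢j ∘ cong suc)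

squarefree? : (α : Vec ℕ k) → Dec (All (_≤ 1) α)
squarefree? = All.all? (ℕ._≤? 1)

distinct⇔squarefree : (u : Vec (Fin k) r) → Distinct u ⇔ All (_≤ 1) (content u)
distinct⇔squarefree u = mk⇔ (λ d → All.tabulate⁺ (distinct⇒occ≤1 u d))
                            (λ sf → occ≤1⇒distinct u (All.tabulate⁻ sf))

updateAt-suc-injective : (c : Fin k) {β α : Vec ℕ k} →
                         updateAt β c suc ≡ updateAt α c suc → β ≡ α
updateAt-suc-injective zero    {b ∷ β} {a ∷ α} eq =
  cong₂ _∷_ (ℕ.suc-injective (Vec.∷-injectiveˡ eq)) (Vec.∷-injectiveʳ eq)
updateAt-suc-injective (suc c) {b ∷ β} {a ∷ α} eq =
  cong₂ _∷_ (Vec.∷-injectiveˡ eq) (updateAt-suc-injective c (Vec.∷-injectiveʳ eq))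

lookup-updateAt-suc : (c : Fin k) (α : Vec ℕ k) → lookup (updateAt α c suc) c ≡ suc (lookup α c)
lookup-updateAt-suc c α = Vec.lookup∘updateAt c α

sum-updateAt-suc : (c : Fin k) (α : Vec ℕ k) → Vec.sum (updateAt α c suc) ≡ suc (Vec.sum α)
sum-updateAt-suc zero    (a ∷ α) = refl
sum-updateAt-suc (suc c) (a ∷ α) =
  trans (cong (a +_) (sum-updateAt-suc c α)) (ℕ.+-suc a (Vec.sum α))

squarefree-updateAt-suc : (c : Fin k) (α : Vec ℕ k) → lookup α c ≡ 0 →
                          All (_≤ 1) α ⇔ All (_≤ 1) (updateAt α c suc)
squarefree-updateAt-suc zero    (zero ∷ α) eq = mk⇔ (λ { (_ ∷ sf) → ℕ.≤-refl ∷ sf }) (λ { (_ ∷ sf) → z≤n ∷ sf })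
squarefree-updateAt-suc (suc c) (a ∷ α)    eq =
  mk⇔ (λ { (a≤1 ∷ sf) → a≤1 ∷ Equivalence.to   ih sf })
      (λ { (a≤1 ∷ sf) → a≤1 ∷ Equivalence.from ih sf })
  where ih = squarefree-updateAt-suc c α eq

updateAt-pred : (c : Fin k) (α : Vec ℕ k) → lookup α c ≢ 0 →
                α ≡ updateAt (updateAt α c ℕ.pred) c suc
updateAt-pred c α α≢0 = sym (trans (Vec.updateAt-updateAt c α)
  (Vec.updateAt-id-local c α (ℕ.suc-pred _ {{ℕ.≢-nonZero α≢0}})))

∑-ι-lookup : (α : Vec ℕ k) → ∑ (allFin k) (λ c → ι (lookup α c)) ≡ ι (Vec.sum α)
∑-ι-lookup []      = refl
∑-ι-lookup {suc k} (a ∷ α) = begin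
  ∑ (allFin (suc k)) (λ c → ι (lookup (a ∷ α) c)) ≡⟨ ∑-allFin-suc k (λ c → ι (lookup (a ∷ α) c)) ⟩
  ι a ℚ.+ ∑ (allFin k) (λ c → ι (lookup α c))     ≡⟨ cong (ι a ℚ.+_) (∑-ι-lookup α) ⟩
  ι a ℚ.+ ι (Vec.sum α)                           ≡⟨ ι-+ a (Vec.sum α) ⟨
  ι (a + Vec.sum α)                               ∎

squarefreeWords : ∀ r {k} → Vec ℕ k → ℚ
squarefreeWords r {k} α = 𝟙 (squarefree? α) ℚ.* ∑ (colorings r k) λ u → δ (content u) α

-- The r distinct letters of a squarefree monomial of degree r can be arranged in r! ways. The
-- induction removes the first letter.
squarefreeWords≡elem : ∀ r {k} (α : Vec ℕ k) → squarefreeWords r α ≡ ι (r !) ℚ.* elem r k α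
squarefreeWords≡elem zero {k} α = begin
  𝟙 (squarefree? α) ℚ.* (δ (content {k = k} []) α ℚ.+ 0ℚ)
    ≡⟨ cong (𝟙 (squarefree? α) ℚ.*_) (trans (ℚ.+-identityʳ _)
         (𝟙-cong (mk⇔ (λ eq → trans (cong Vec.sum (sym eq)) (sum-content-[] k)) (content-[] α))
                 (Vec.≡-dec ℕ._≟_ (content {k = k} []) α) (Vec.sum α ℕ.≟ 0))) ⟩
  𝟙 (squarefree? α) ℚ.* 𝟙 (Vec.sum α ℕ.≟ 0)
    ≡⟨ 𝟙-× (squarefree? α) (Vec.sum α ℕ.≟ 0) ⟨
  elem 0 k α
    ≡⟨ ℚ.*-identityˡ (elem 0 k α) ⟨
  1ℚ ℚ.* elem 0 k α ∎
  where
  sum-content-[] : ∀ k → Vec.sum (content {k = k} []) ≡ 0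
  sum-content-[] zero    = refl
  sum-content-[] (suc k) = sum-content-[] k

  content-[] : ∀ {k} (α : Vec ℕ k) → Vec.sum α ≡ 0 → content [] ≡ α
  content-[] []         eq = refl
  content-[] (zero ∷ α) eq = cong (0 ∷_) (content-[] α eq)
squarefreeWords≡elem (suc r) {k} α = begin
  𝟙 (squarefree? α) ℚ.* ∑ (colorings (suc r) k) (λ u → δ (content u) α)
    ≡⟨ cong (𝟙 (squarefree? α) ℚ.*_) (∑-colorings-suc r λ u → δ (content u) α) ⟩
  𝟙 (squarefree? α) ℚ.* ∑ (allFin k) (λ c → ∑ (colorings r k) λ u → δ (content (c ∷ u)) α)
    ≡⟨ ∑-*ˡ (𝟙 (squarefree? α)) (allFin k) (λ c → ∑ (colorings r k) λ u → δ (content (c ∷ u)) α) ⟨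
  ∑ (allFin k) (λ c → 𝟙 (squarefree? α) ℚ.* ∑ (colorings r k) λ u → δ (content (c ∷ u)) α)
    ≡⟨ ∑-cong (allFin k) byFirst ⟩
  ∑ (allFin k) (λ c → ι (lookup α c) ℚ.* (ι (r !) ℚ.* elem (suc r) k α))
    ≡⟨ ∑-*ʳ (ι (r !) ℚ.* elem (suc r) k α) (allFin k) (λ c → ι (lookup α c)) ⟩
  ∑ (allFin k) (λ c → ι (lookup α c)) ℚ.* (ι (r !) ℚ.* elem (suc r) k α)
    ≡⟨ cong (ℚ._* (ι (r !) ℚ.* elem (suc r) k α)) (∑-ι-lookup α) ⟩
  ι (Vec.sum α) ℚ.* (ι (r !) ℚ.* elem (suc r) k α)
    ≡⟨ solve 3 (λ x y z → x :* (y :* z) := z :* (x :* y)) refl (ι (Vec.sum α)) (ι (r !)) _ ⟩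
  elem (suc r) k α ℚ.* (ι (Vec.sum α) ℚ.* ι (r !))
    -- Where `elem` does not vanish the degree of `α` is r + 1, which turns the factor into (r +
    -- 1)!.
    ≡⟨ 𝟙-*-cong (squarefree? α ×-dec (Vec.sum α ℕ.≟ suc r))
         (λ { (_ , sum≡) → trans (cong (λ n → ι n ℚ.* ι (r !)) sum≡) (sym (ι-* (suc r) (r !))) }) ⟩
  elem (suc r) k α ℚ.* ι (suc r !)
    ≡⟨ ℚ.*-comm (elem (suc r) k α) (ι (suc r !)) ⟩
  ι (suc r !) ℚ.* elem (suc r) k α ∎
  where
  -- For squarefree `α` of degree r + 1, the letter `c` can come first in α_c ways, that is 0 or 1,
  -- and the other letters follow in r! orders.
  withFirst : Fin k → Vec ℕ k → Set
  withFirst c α = 𝟙 (squarefree? α) ℚ.* ∑ (colorings r k) (λ u → δ (content (c ∷ u)) α) ≡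
                  ι (lookup α c) ℚ.* (ι (r !) ℚ.* elem (suc r) k α)

  unused : ∀ c → lookup α c ≡ 0 → withFirst c α
  unused c α≡0 = begin
    𝟙 (squarefree? α) ℚ.* ∑ (colorings r k) (λ u → δ (content (c ∷ u)) α)
      ≡⟨ cong (𝟙 (squarefree? α) ℚ.*_) (trans
           (∑-cong (colorings r k) λ u → 𝟙-no (Vec.≡-dec ℕ._≟_ (content (c ∷ u)) α) λ eq →
             contradiction (begin
               suc (occ c u)                ≡⟨ occ-head c u ⟨
               occ c (c ∷ u)                ≡⟨ Vec.lookup∘tabulate (λ d → occ d (c ∷ u)) c ⟨
               lookup (content (c ∷ u)) c   ≡⟨ cong (λ β → lookup β c) eq ⟩
               lookup α c                   ≡⟨ α≡0 ⟩
               0                            ∎) λ ())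
           (∑-zero (colorings r k))) ⟩
    𝟙 (squarefree? α) ℚ.* 0ℚ
      ≡⟨ trans (ℚ.*-zeroʳ (𝟙 (squarefree? α))) (sym (ℚ.*-zeroˡ (ι (r !) ℚ.* elem (suc r) k α))) ⟩
    0ℚ ℚ.* (ι (r !) ℚ.* elem (suc r) k α)
      ≡⟨ cong (λ n → ι n ℚ.* (ι (r !) ℚ.* elem (suc r) k α)) α≡0 ⟨
    ι (lookup α c) ℚ.* (ι (r !) ℚ.* elem (suc r) k α) ∎

  -- Stated for the increased vector, so that `α` itself is the content of the remaining r letters
  -- and the induction applies to it.
  used : ∀ c α → withFirst c (updateAt α c suc)
  used c α with lookup α c ℕ.≟ 0
  ... | yes α≡0 = begin
    𝟙 (squarefree? α⁺) ℚ.* ∑ (colorings r k) (λ u → δ (content (c ∷ u)) α⁺)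
      ≡⟨ cong₂ ℚ._*_
           (𝟙-cong (Equiv.sym squarefree⇔) (squarefree? α⁺) (squarefree? α))
           (∑-cong (colorings r k) λ u → 𝟙-cong
             (mk⇔ (λ eq → updateAt-suc-injective c (trans (sym (content-∷ c u)) eq))
                  (λ eq → trans (content-∷ c u) (cong (λ β → updateAt β c suc) eq)))
             (Vec.≡-dec ℕ._≟_ (content (c ∷ u)) α⁺) (Vec.≡-dec ℕ._≟_ (content u) α)) ⟩
    squarefreeWords r α
      ≡⟨ squarefreeWords≡elem r α ⟩
    ι (r !) ℚ.* elem r k α
      ≡⟨ cong (ι (r !) ℚ.*_) (𝟙-cong
           (mk⇔ (λ { (sf , eq) → Equivalence.to squarefree⇔ sf , trans (sum-updateAt-suc c α) (cong suc eq) })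
                (λ { (sf , eq) → Equivalence.from squarefree⇔ sf
                               , ℕ.suc-injective (trans (sym (sum-updateAt-suc c α)) eq) }))
           (squarefree? α ×-dec (Vec.sum α ℕ.≟ r)) (squarefree? α⁺ ×-dec (Vec.sum α⁺ ℕ.≟ suc r))) ⟩
    ι (r !) ℚ.* elem (suc r) k α⁺
      ≡⟨ ℚ.*-identityˡ (ι (r !) ℚ.* elem (suc r) k α⁺) ⟨
    1ℚ ℚ.* (ι (r !) ℚ.* elem (suc r) k α⁺)
      ≡⟨ cong (λ n → ι n ℚ.* (ι (r !) ℚ.* elem (suc r) k α⁺))
           (trans (lookup-updateAt-suc c α) (cong suc α≡0)) ⟨
    ι (lookup α⁺ c) ℚ.* (ι (r !) ℚ.* elem (suc r) k α⁺) ∎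
    where
    α⁺ = updateAt α c suc
    squarefree⇔ = squarefree-updateAt-suc c α α≡0
  -- Here the exponent of `c` in `α⁺` is at least 2, so both sides vanish.
  ... | no α≢0 = begin
    𝟙 (squarefree? α⁺) ℚ.* ∑ (colorings r k) (λ u → δ (content (c ∷ u)) α⁺)
      ≡⟨ cong (ℚ._* ∑ (colorings r k) (λ u → δ (content (c ∷ u)) α⁺)) (𝟙-no (squarefree? α⁺) ¬squarefree) ⟩
    0ℚ ℚ.* ∑ (colorings r k) (λ u → δ (content (c ∷ u)) α⁺)
      ≡⟨ solve 3 (λ x y z → con 0ℚ :* x := y :* (z :* con 0ℚ)) refl
           (∑ (colorings r k) λ u → δ (content (c ∷ u)) α⁺) (ι (lookup α⁺ c)) (ι (r !)) ⟩
    ι (lookup α⁺ c) ℚ.* (ι (r !) ℚ.* 0ℚ)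
      ≡⟨ cong (λ q → ι (lookup α⁺ c) ℚ.* (ι (r !) ℚ.* q))
           (𝟙-no (squarefree? α⁺ ×-dec (Vec.sum α⁺ ℕ.≟ suc r)) (¬squarefree ∘ proj₁)) ⟨
    ι (lookup α⁺ c) ℚ.* (ι (r !) ℚ.* elem (suc r) k α⁺) ∎
    where
    α⁺ = updateAt α c suc
    ¬squarefree : ¬ All (_≤ 1) α⁺
    ¬squarefree sf = α≢0 (ℕ.n≤0⇒n≡0 (ℕ.s≤s⁻¹
      (subst (_≤ 1) (lookup-updateAt-suc c α) (All.lookup⁺ sf c))))

  byFirst : ∀ c → withFirst c α
  byFirst c with lookup α c ℕ.≟ 0
  ... | yes α≡0 = unused c α≡0
  ... | no  α≢0 = subst (withFirst c) (sym (updateAt-pred c α α≢0)) (used c (updateAt α c ℕ.pred))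

X-coloring : ∀ {N} (G : Graph N) k (α : Vec ℕ k) →
             X G k α ≡ ∑ (colorings N k) λ κ → 𝟙 (proper? G κ) ℚ.* δ (content κ) α
X-coloring {N} G k α = ∑-filter (proper? G) (colorings N k) λ κ → monomialCoeff κ α

-- The factor `δ` fixes the content, so distinctness of the colors becomes squarefreeness of `α`, a
-- condition that leaves the sum.
X-K : ∀ r → X (graph (K r)) ≈ˢ ι (r !) • elem r
X-K r k α = begin
  X (graph (K r)) k α
    ≡⟨ X-coloring (graph (K r)) k α ⟩
  ∑ (colorings r k) (λ u → 𝟙 (distinct? u) ℚ.* δ (content u) α)
    ≡⟨ ∑-cong (colorings r k) (λ u → begin
         𝟙 (distinct? u) ℚ.* δ (content u) α
           ≡⟨ ℚ.*-comm (𝟙 (distinct? u)) _ ⟩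
         δ (content u) α ℚ.* 𝟙 (distinct? u)
           ≡⟨ 𝟙-*-cong (Vec.≡-dec ℕ._≟_ (content u) α) (λ eq →
                𝟙-cong (subst (λ β → Distinct u ⇔ All (_≤ 1) β) eq (distinct⇔squarefree u))
                       (distinct? u) (squarefree? α)) ⟩
         δ (content u) α ℚ.* 𝟙 (squarefree? α)
           ≡⟨ ℚ.*-comm _ (𝟙 (squarefree? α)) ⟩
         𝟙 (squarefree? α) ℚ.* δ (content u) α ∎) ⟩
  ∑ (colorings r k) (λ u → 𝟙 (squarefree? α) ℚ.* δ (content u) α)
    ≡⟨ ∑-*ˡ (𝟙 (squarefree? α)) (colorings r k) (λ u → δ (content u) α) ⟩
  squarefreeWords r α
    ≡⟨ squarefreeWords≡elem r α ⟩
  ι (r !) ℚ.* elem r k α ∎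

-- The recurrence for lollipop graphs

X-cong : ∀ {N} (G H : Graph N) → (∀ i j → _~_ G i j ⇔ _~_ H i j) → X G ≈ˢ X H
X-cong {N} G H G⇔H k α = begin
  X G k α
    ≡⟨ X-coloring G k α ⟩
  ∑ (colorings N k) (λ κ → 𝟙 (proper? G κ) ℚ.* δ (content κ) α)
    ≡⟨ ∑-cong (colorings N k) (λ κ → cong (ℚ._* δ (content κ) α)
         (𝟙-cong (mk⇔ (λ p i j → p i j ∘ Equivalence.from (G⇔H i j))
                      (λ p i j → p i j ∘ Equivalence.to   (G⇔H i j)))
                 (proper? G κ) (proper? H κ))) ⟩
  ∑ (colorings N k) (λ κ → 𝟙 (proper? H κ) ℚ.* δ (content κ) α)
    ≡⟨ X-coloring H k α ⟨
  X H k α ∎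

X-L-0 : ∀ {N} m (eq : m + 0 ≡ N) → X (graph (L m 0 eq)) ≈ˢ X (graph (K N))
X-L-0 {N} m eq = X-cong (graph (L m 0 eq)) (graph (K N)) λ i j → mk⇔
  (λ { (inj₁ (i≢j , _))              → i≢j
     ; (inj₂ (inj₁ (m≤i , j≡1+i))) → contradiction (short j) (ℕ.<⇒≱ (subst (m ℕ.<_) (sym j≡1+i) (s≤s m≤i)))
     ; (inj₂ (inj₂ (m≤j , i≡1+j))) → contradiction (short i) (ℕ.<⇒≱ (subst (m ℕ.<_) (sym i≡1+j) (s≤s m≤j))) })
  (λ i≢j → inj₁ (i≢j , short i , short j))
  where
  short : (i : Fin N) → label i ≤ m
  short i = subst (label i ≤_) (trans (sym eq) (ℕ.+-identityʳ m)) (Fin.toℕ<n i)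

X-L-1 : ∀ {N} n (eq : 1 + n ≡ N) → X (graph (L 1 n eq)) ≈ˢ X (graph (P N))
X-L-1 {N} n eq = X-cong (graph (L 1 n eq)) (graph (P N)) λ i j → mk⇔
  (λ { (inj₁ (i≢j , i≤1 , j≤1)) → contradiction
         (Fin.toℕ-injective (trans (ℕ.n≤0⇒n≡0 (ℕ.s≤s⁻¹ i≤1)) (sym (ℕ.n≤0⇒n≡0 (ℕ.s≤s⁻¹ j≤1))))) i≢j
     ; (inj₂ (inj₁ (_ , j≡1+i))) → inj₁ j≡1+i
     ; (inj₂ (inj₂ (_ , i≡1+j))) → inj₂ i≡1+j })
  (λ { (inj₁ j≡1+i) → inj₂ (inj₁ (s≤s z≤n , j≡1+i))
     ; (inj₂ i≡1+j) → inj₂ (inj₂ (s≤s z≤n , i≡1+j)) })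

-- K_r and P_{n+1}, on the first r and the last n + 1 vertices, with the
-- vertices of K_r satisfying J joined to the first vertex of the path.
record IsAttachment (r n : ℕ) (J : Fin r → Set) (G : Graph (r + suc n)) : Set where
  field
    clique  : ∀ i j → _~_ G (i ↑ˡ suc n) (j ↑ˡ suc n) ⇔ i ≢ j
    path    : ∀ i j → _~_ G (r ↑ʳ i) (r ↑ʳ j) ⇔ _~_ (graph (P (suc n))) i j
    joining : ∀ i j → _~_ G (i ↑ˡ suc n) (r ↑ʳ j) ⇔ (J i × j ≡ zero)

Avoids : (J : Fin r → Set) → Fin k → Vec (Fin k) r → Set
Avoids J c u = ∀ i → J i → lookup u i ≢ c

avoids? : {J : Fin r → Set} → (∀ i → Dec (J i)) → (c : Fin k) (u : Vec (Fin k) r) → Dec (Avoids J c u)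
avoids? J? c u = Fin.all? λ i → J? i →-dec ¬? (lookup u i Fin.≟ c)

module _ {r n : ℕ} where

  ↑-elim : (Q : Fin (r + n) → Set) → (∀ i → Q (i ↑ˡ n)) → (∀ j → Q (r ↑ʳ j)) → ∀ i → Q i
  ↑-elim Q left right i = subst Q (Fin.join-splitAt r n i) (go (Fin.splitAt r i))
    where
    go : ∀ x → Q (Fin.join r n x)
    go (inj₁ i) = left i
    go (inj₂ j) = right j

module _ {r n : ℕ} {J : Fin r → Set} {G : Graph (r + suc n)} (attachment : IsAttachment r n J G) where
  open IsAttachment attachment
  open Equivalence

  -- Edges between the two parts meet the path only in its first vertex, so `w` restricts `u` only
  -- through its first color.
  proper-++ : (u : Vec (Fin k) r) (w : Vec (Fin k) (suc n)) →
    Proper G (u Vec.++ w) ⇔ (Distinct u × Proper (graph (P (suc n))) w × Avoids J (lookup w zero) u)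
  proper-++ u w = mk⇔
    (λ p → (λ i j i≢j uᵢ≡uⱼ → p _ _ (clique i j .from i≢j) (trans (left i) (trans uᵢ≡uⱼ (sym (left j)))))
         , (λ i j i~j wᵢ≡wⱼ → p _ _ (path i j .from i~j) (trans (right i) (trans wᵢ≡wⱼ (sym (right j)))))
         , (λ i Ji uᵢ≡w₀ → p _ _ (joining i zero .from (Ji , refl)) (trans (left i) (trans uᵢ≡w₀ (sym (right zero))))))
    (λ { (d , p , a) →
      ↑-elim _
        (λ i → ↑-elim _
          (λ j e eq → d i j (clique i j .to e) (trans (sym (left i)) (trans eq (left j))))
          (λ j e eq → avoid a i j e (trans (sym (left i)) (trans eq (right j)))))
        (λ i → ↑-elim _
          (λ j e eq → avoid a j i (Graph.~-sym G e) (trans (sym (left j)) (trans (sym eq) (right i))))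
          (λ j e eq → p i j (path i j .to e) (trans (sym (right i)) (trans eq (right j))))) })
    where
    left : ∀ i → lookup (u Vec.++ w) (i ↑ˡ suc n) ≡ lookup u i
    left = Vec.lookup-++ˡ u w
    right : ∀ j → lookup (u Vec.++ w) (r ↑ʳ j) ≡ lookup w j
    right = Vec.lookup-++ʳ u w

    avoid : Avoids J (lookup w zero) u → ∀ i j → _~_ G (i ↑ˡ suc n) (r ↑ʳ j) → lookup u i ≢ lookup w j
    avoid a i j e with joining i j .to e
    ... | Ji , refl = a i Ji

-- Lollipop graphs as a clique attached to a path

module Positions (r n : ℕ) where

  left : (i : Fin r) → toℕ (i ↑ˡ suc n) ℕ.< r
  left i = subst (ℕ._< r) (sym (Fin.toℕ-↑ˡ i (suc n))) (Fin.toℕ<n i)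

  right : (j : Fin (suc n)) → r ≤ toℕ (r ↑ʳ j)
  right j = subst (r ≤_) (sym (Fin.toℕ-↑ʳ r j)) (ℕ.m≤m+n r (toℕ j))

  first : (j : Fin (suc n)) → toℕ (r ↑ʳ j) ≤ r → j ≡ zero
  first zero    _   = refl
  first (suc j) j≤r = contradiction j≤r
    (ℕ.<⇒≱ (subst (r ℕ.<_) (sym (Fin.toℕ-↑ʳ r (suc j))) (ℕ.m<m+n r (s≤s z≤n))))

  shiftˡ : (i j : Fin (suc n)) → label (r ↑ʳ j) ≡ suc (label (r ↑ʳ i)) → label j ≡ suc (label i)
  shiftˡ i j eq = cong suc (ℕ.+-cancelˡ-≡ r (toℕ j) (suc (toℕ i)) (begin
    r + toℕ j               ≡⟨ Fin.toℕ-↑ʳ r j ⟨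
    toℕ (r ↑ʳ j)            ≡⟨ ℕ.suc-injective eq ⟩
    suc (toℕ (r ↑ʳ i))      ≡⟨ cong suc (Fin.toℕ-↑ʳ r i) ⟩
    suc (r + toℕ i)         ≡⟨ ℕ.+-suc r (toℕ i) ⟨
    r + suc (toℕ i)         ∎))

  shiftʳ : (i j : Fin (suc n)) → label j ≡ suc (label i) → label (r ↑ʳ j) ≡ suc (label (r ↑ʳ i))
  shiftʳ i j eq = cong suc (begin
    toℕ (r ↑ʳ j)            ≡⟨ Fin.toℕ-↑ʳ r j ⟩
    r + toℕ j               ≡⟨ cong (r +_) (ℕ.suc-injective eq) ⟩
    r + suc (toℕ i)         ≡⟨ ℕ.+-suc r (toℕ i) ⟩
    suc (r + toℕ i)         ≡⟨ cong suc (Fin.toℕ-↑ʳ r i) ⟨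
    suc (toℕ (r ↑ʳ i))      ∎)

-- The first path vertex has label r + 1. It is the last vertex of the clique of size r + 1 and
-- hence adjacent to the r others.
L-suc-attachment : ∀ r n (eq : suc r + n ≡ r + suc n) →
                   IsAttachment r n (λ _ → ⊤) (graph (L (suc r) n eq))
L-suc-attachment r n eq = record
  { clique  = λ i j → mk⇔
      (λ { (inj₁ (i≢j , _)) → i≢j ∘ cong (_↑ˡ suc n)
         ; (inj₂ (inj₁ (r≤i , _))) → contradiction (ℕ.s≤s⁻¹ r≤i) (ℕ.<⇒≱ (left i))
         ; (inj₂ (inj₂ (r≤j , _))) → contradiction (ℕ.s≤s⁻¹ r≤j) (ℕ.<⇒≱ (left j)) })
      (λ i≢j → inj₁ (i≢j ∘ Fin.↑ˡ-injective (suc n) i j , ℕ.≤-trans (left i) (ℕ.n≤1+n r) , ℕ.≤-trans (left j) (ℕ.n≤1+n r)))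
  ; path    = λ i j → mk⇔
      (λ { (inj₁ (i≢j , i≤r , j≤r)) → contradiction (cong (r ↑ʳ_) (trans (first i (ℕ.s≤s⁻¹ i≤r)) (sym (first j (ℕ.s≤s⁻¹ j≤r))))) i≢j
         ; (inj₂ (inj₁ (_ , j≡1+i))) → inj₁ (shiftˡ i j j≡1+i)
         ; (inj₂ (inj₂ (_ , i≡1+j))) → inj₂ (shiftˡ j i i≡1+j) })
      (λ { (inj₁ j≡1+i) → inj₂ (inj₁ (s≤s (right i) , shiftʳ i j j≡1+i))
         ; (inj₂ i≡1+j) → inj₂ (inj₂ (s≤s (right j) , shiftʳ j i i≡1+j)) })
  ; joining = λ i j → mk⇔
      (λ { (inj₁ (_ , _ , j≤r)) → tt , first j (ℕ.s≤s⁻¹ j≤r)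
         ; (inj₂ (inj₁ (r≤i , _))) → contradiction (ℕ.s≤s⁻¹ r≤i) (ℕ.<⇒≱ (left i))
         ; (inj₂ (inj₂ (_ , i≡1+j))) → contradiction
             (ℕ.≤-trans (right j) (ℕ.≤-trans (ℕ.n≤1+n _) (ℕ.≤-reflexive (sym (ℕ.suc-injective i≡1+j)))))
             (ℕ.<⇒≱ (left i)) })
      (λ { (_ , refl) → inj₁ (Fin.<⇒≢ (ℕ.≤-trans (left i) (right zero))
                             , ℕ.≤-trans (left i) (ℕ.n≤1+n r)
                             , ℕ.≤-reflexive (cong suc (trans (Fin.toℕ-↑ʳ r zero) (ℕ.+-identityʳ r)))) })
  }
  where open Positions r n

-- The clique ends at label s + 1, which is the vertex `fromℕ s`. The only edge to the path is the
-- first tail edge, from label s + 1 to label s + 2.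
L-last-attachment : ∀ s n (eq : suc s + suc n ≡ suc s + suc n) →
                    IsAttachment (suc s) n (_≡ fromℕ s) (graph (L (suc s) (suc n) eq))
L-last-attachment s n eq = record
  { clique  = λ i j → mk⇔
      (λ { (inj₁ (i≢j , _)) → i≢j ∘ cong (_↑ˡ suc n)
         ; (inj₂ (inj₁ (s≤i , j≡1+i))) → contradiction (subst (suc s ≤_) (sym (ℕ.suc-injective j≡1+i)) s≤i) (ℕ.<⇒≱ (left j))
         ; (inj₂ (inj₂ (s≤j , i≡1+j))) → contradiction (subst (suc s ≤_) (sym (ℕ.suc-injective i≡1+j)) s≤j) (ℕ.<⇒≱ (left i)) })
      (λ i≢j → inj₁ (i≢j ∘ Fin.↑ˡ-injective (suc n) i j , left i , left j))
  ; path    = λ i j → mk⇔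
      (λ { (inj₁ (_ , i≤s , _)) → contradiction i≤s (ℕ.<⇒≱ (s≤s (right i)))
         ; (inj₂ (inj₁ (_ , j≡1+i))) → inj₁ (shiftˡ i j j≡1+i)
         ; (inj₂ (inj₂ (_ , i≡1+j))) → inj₂ (shiftˡ j i i≡1+j) })
      (λ { (inj₁ j≡1+i) → inj₂ (inj₁ (ℕ.≤-trans (right i) (ℕ.n≤1+n _) , shiftʳ i j j≡1+i))
         ; (inj₂ i≡1+j) → inj₂ (inj₂ (ℕ.≤-trans (right j) (ℕ.n≤1+n _) , shiftʳ j i i≡1+j)) })
  ; joining = λ i j → mk⇔
      (λ { (inj₁ (_ , _ , j≤s)) → contradiction j≤s (ℕ.<⇒≱ (s≤s (right j)))
         ; (inj₂ (inj₁ (s≤i , j≡1+i))) →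
             Fin.toℕ-injective (trans (sym (Fin.toℕ-↑ˡ i (suc n)))
               (trans (ℕ.≤-antisym (ℕ.s≤s⁻¹ (left i)) (ℕ.s≤s⁻¹ s≤i)) (sym (Fin.toℕ-fromℕ s))))
           , first j (subst (_≤ suc s) (sym (ℕ.suc-injective j≡1+i)) (left i))
         ; (inj₂ (inj₂ (_ , i≡1+j))) → contradiction
             (ℕ.≤-trans (right j) (ℕ.≤-trans (ℕ.n≤1+n _) (ℕ.≤-reflexive (sym (ℕ.suc-injective i≡1+j)))))
             (ℕ.<⇒≱ (left i)) })
      (λ { (refl , refl) →
           let i≡s = trans (Fin.toℕ-↑ˡ (fromℕ s) (suc n)) (Fin.toℕ-fromℕ s) in
           inj₂ (inj₁ ( s≤s (ℕ.≤-reflexive (sym i≡s))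
                      , cong suc (trans (trans (Fin.toℕ-↑ʳ (suc s) zero) (ℕ.+-identityʳ (suc s)))
                                        (cong suc (sym i≡s))))) })
  }
  where open Positions (suc s) n

module _ {r n : ℕ} {k : ℕ} (α : Vec ℕ k) where

  -- The weight of a clique coloring `u` once the path coloring `w` is fixed, before any condition
  -- links the two. Such conditions enter as separate factors, since they break the symmetry in `u`.
  completion : Vec (Fin k) (suc n) → Vec (Fin k) r → ℚ
  completion w u = 𝟙 (distinct? u) ℚ.* δ (zipWith _+_ (content u) (content w)) α

  -- Distinctness is a condition on the content too: every color occurs at most once.
  completion-symmetric : ∀ w → Symmetric (completion w)
  completion-symmetric w u v occ≡ = cong₂ ℚ._*_
    (𝟙-cong (mk⇔ (λ d → occ≤1⇒distinct v λ c → subst (_≤ 1) (occ≡ c) (distinct⇒occ≤1 u d c))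
                 (λ d → occ≤1⇒distinct u λ c → subst (_≤ 1) (sym (occ≡ c)) (distinct⇒occ≤1 v d c)))
            (distinct? u) (distinct? v))
    (cong (λ β → δ (zipWith _+_ β (content w)) α) (Vec.tabulate-cong occ≡))

  X-attachment : {J : Fin r → Set} (J? : ∀ i → Dec (J i)) {G : Graph (r + suc n)} → IsAttachment r n J G →
    X G k α ≡ ∑ (colorings (suc n) k) λ w → 𝟙 (proper? (graph (P (suc n))) w) ℚ.*
                ∑ (colorings r k) λ u → completion w u ℚ.* 𝟙 (avoids? J? (lookup w zero) u)
  X-attachment J? {G} attachment = begin
    X G k α
      ≡⟨ X-coloring G k α ⟩
    ∑ (colorings (r + suc n) k) (λ κ → 𝟙 (proper? G κ) ℚ.* δ (content κ) α)
      ≡⟨ ∑-colorings-++ r (suc n) (λ κ → 𝟙 (proper? G κ) ℚ.* δ (content κ) α) ⟩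
    ∑ (colorings r k) (λ u → ∑ (colorings (suc n) k) λ w →
      𝟙 (proper? G (u Vec.++ w)) ℚ.* δ (content (u Vec.++ w)) α)
      ≡⟨ ∑-swap (colorings r k) (colorings (suc n) k)
           (λ u w → 𝟙 (proper? G (u Vec.++ w)) ℚ.* δ (content (u Vec.++ w)) α) ⟩
    ∑ (colorings (suc n) k) (λ w → ∑ (colorings r k) λ u →
      𝟙 (proper? G (u Vec.++ w)) ℚ.* δ (content (u Vec.++ w)) α)
      ≡⟨ ∑-cong (colorings (suc n) k) (λ w → trans
           (∑-cong (colorings r k) λ u → split u w)
           (∑-*ˡ (𝟙 (path? w)) (colorings r k)
             λ u → completion w u ℚ.* 𝟙 (avoids? J? (lookup w zero) u))) ⟩
    ∑ (colorings (suc n) k) (λ w → 𝟙 (path? w) ℚ.*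
      ∑ (colorings r k) λ u → completion w u ℚ.* 𝟙 (avoids? J? (lookup w zero) u)) ∎
    where
    path? : (w : Vec (Fin k) (suc n)) → Dec (Proper (graph (P (suc n))) w)
    path? = proper? (graph (P (suc n)))

    split : ∀ u w → 𝟙 (proper? G (u Vec.++ w)) ℚ.* δ (content (u Vec.++ w)) α ≡
                    𝟙 (path? w) ℚ.* (completion w u ℚ.* 𝟙 (avoids? J? (lookup w zero) u))
    split u w = begin
      𝟙 (proper? G (u Vec.++ w)) ℚ.* δ (content (u Vec.++ w)) α
        ≡⟨ cong₂ ℚ._*_
             (𝟙-cong (proper-++ attachment u w) (proper? G (u Vec.++ w)) (distinct? u ×-dec path? w ×-dec avoid))
             (cong (λ β → δ β α) (content-++ u w)) ⟩
      𝟙 (distinct? u ×-dec path? w ×-dec avoid) ℚ.* q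
        ≡⟨ cong (ℚ._* q) (trans (𝟙-× (distinct? u) (path? w ×-dec avoid))
             (cong (𝟙 (distinct? u) ℚ.*_) (𝟙-× (path? w) avoid))) ⟩
      𝟙 (distinct? u) ℚ.* (𝟙 (path? w) ℚ.* 𝟙 avoid) ℚ.* q
        ≡⟨ solve 4 (λ x y z t → x :* (y :* z) :* t := y :* ((x :* t) :* z)) refl
             (𝟙 (distinct? u)) (𝟙 (path? w)) (𝟙 avoid) q ⟩
      𝟙 (path? w) ℚ.* (completion w u ℚ.* 𝟙 avoid) ∎
      where
      avoid = avoids? J? (lookup w zero) u
      q     = δ (zipWith _+_ (content u) (content w)) α

  -- Multiplying monomials adds contents, so the product is the same double sum as for an attachment
  -- with no joining edges, the disjoint union.
  X-K·X-P : (X (graph (K r)) · X (graph (P (suc n)))) k α ≡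
            ∑ (colorings (suc n) k) λ w → 𝟙 (proper? (graph (P (suc n))) w) ℚ.*
              ∑ (colorings r k) (completion w)
  X-K·X-P = begin
    conv (X (graph (K r)) k) (X (graph (P (suc n))) k) α
      ≡⟨ conv-cong (X-coloring (graph (K r)) k) (X-coloring (graph (P (suc n))) k) α ⟩
    conv (λ β → ∑ (colorings r k) λ u → 𝟙 (distinct? u) ℚ.* δ (content u) β)
         (λ β → ∑ (colorings (suc n) k) λ w → 𝟙 (path? w) ℚ.* δ (content w) β) α
      ≡⟨ conv-∑ʳ (λ β → ∑ (colorings r k) λ u → 𝟙 (distinct? u) ℚ.* δ (content u) β)
           (colorings (suc n) k) (λ w β → 𝟙 (path? w) ℚ.* δ (content w) β) α ⟩
    ∑ (colorings (suc n) k) (λ w →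
      conv (λ β → ∑ (colorings r k) λ u → 𝟙 (distinct? u) ℚ.* δ (content u) β)
           (λ β → 𝟙 (path? w) ℚ.* δ (content w) β) α)
      ≡⟨ ∑-cong (colorings (suc n) k) (λ w → trans
           (conv-*ʳ (𝟙 (path? w)) (λ β → ∑ (colorings r k) λ u → 𝟙 (distinct? u) ℚ.* δ (content u) β) (δ (content w)) α)
           (cong (𝟙 (path? w) ℚ.*_) (trans
             (conv-∑ˡ (colorings r k) (λ u β → 𝟙 (distinct? u) ℚ.* δ (content u) β) (δ (content w)) α)
             (∑-cong (colorings r k) λ u → trans
               (conv-*ˡ (𝟙 (distinct? u)) (δ (content u)) (δ (content w)) α)
               (cong (𝟙 (distinct? u) ℚ.*_) (conv-δ-δ (content u) (content w) α)))))) ⟩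
    ∑ (colorings (suc n) k) (λ w → 𝟙 (path? w) ℚ.* ∑ (colorings r k) (completion w)) ∎
    where
    path? : (w : Vec (Fin k) (suc n)) → Dec (Proper (graph (P (suc n))) w)
    path? = proper? (graph (P (suc n)))

⊤? : ∀ {r} (i : Fin r) → Dec ⊤
⊤? i = yes tt

-- A color occurs at most once among distinct ones, so `1ℚ ℚ.- ι (occ c u)` is itself an indicator.
-- This makes avoidance linear in `occ c u`.
𝟙-distinct-avoids : (c : Fin k) (u : Vec (Fin k) r) →
  𝟙 (distinct? u) ℚ.* 𝟙 (avoids? ⊤? c u) ≡ 𝟙 (distinct? u) ℚ.* (1ℚ ℚ.- ι (occ c u))
𝟙-distinct-avoids c u = 𝟙-*-cong (distinct? u) λ d → value (occ c u) refl (distinct⇒occ≤1 u d c)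
  where
  value : ∀ m → occ c u ≡ m → m ≤ 1 → 𝟙 (avoids? ⊤? c u) ≡ 1ℚ ℚ.- ι (occ c u)
  value zero       eq _ = trans (𝟙-yes (avoids? ⊤? c u) λ i _ → occ≡0⇒≢ c u eq i)
                                (cong (λ m → 1ℚ ℚ.- ι m) (sym eq))
  value (suc zero) eq _ = trans
    (𝟙-no (avoids? ⊤? c u) λ a → contradiction (trans (sym eq) (≢⇒occ≡0 c u λ i → a i tt)) λ ())
    (cong (λ m → 1ℚ ℚ.- ι m) (sym eq))
  value (suc (suc m)) _ (s≤s ())

𝟙-avoids-last : (c : Fin k) (u : Vec (Fin k) (suc s)) →
  𝟙 (avoids? (Fin._≟ fromℕ s) c u) ≡ 1ℚ ℚ.- 𝟙 (c Fin.≟ lookup u (fromℕ s))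
𝟙-avoids-last {s = s} c u with c Fin.≟ lookup u (fromℕ s)
... | yes c≡ = 𝟙-no  (avoids? (Fin._≟ fromℕ s) c u) λ a → a (fromℕ s) refl (sym c≡)
... | no  c≢ = 𝟙-yes (avoids? (Fin._≟ fromℕ s) c u) λ { _ refl eq → c≢ (sym eq) }

-- A word u of distinct letters avoids c with weight 1 − occ c u, and by symmetry
-- occ c u has the same total weight as s + 1 times the indicator of c being last.
avoids-recurrence : (c : Fin k) {φ ψ : Vec (Fin k) (suc s) → ℚ} →
  (∀ u → φ u ≡ 𝟙 (distinct? u) ℚ.* ψ u) → Symmetric φ →
  ∑ (colorings (suc s) k) (λ u → φ u ℚ.* 𝟙 (avoids? ⊤? c u)) ℚ.+ ι s ℚ.* ∑ (colorings (suc s) k) φ ≡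
  ι (suc s) ℚ.* ∑ (colorings (suc s) k) (λ u → φ u ℚ.* 𝟙 (avoids? (Fin._≟ fromℕ s) c u))
avoids-recurrence {k} {s} c {φ} {ψ} φ≡ φ-sym = begin
  ∑ words (λ u → φ u ℚ.* 𝟙 (avoids? ⊤? c u)) ℚ.+ ι s ℚ.* ∑ words φ
    ≡⟨ cong (ℚ._+ ι s ℚ.* ∑ words φ) (trans (∑-cong words avoid-all) (∑-complement (ι ∘ occ c))) ⟩
  (∑ words φ ℚ.- ∑ words (λ u → φ u ℚ.* ι (occ c u))) ℚ.+ ι s ℚ.* ∑ words φ
    ≡⟨ cong (λ q → (∑ words φ ℚ.- q) ℚ.+ ι s ℚ.* ∑ words φ) (∑-occ c φ φ-sym) ⟩
  (∑ words φ ℚ.- ι (suc s) ℚ.* ∑ words (λ u → φ u ℚ.* last u)) ℚ.+ ι s ℚ.* ∑ words φ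
    ≡⟨ solve 3 (λ x y z → (y :- (con 1ℚ :+ x) :* z) :+ x :* y := (con 1ℚ :+ x) :* (y :- z)) refl
         (ι s) (∑ words φ) (∑ words λ u → φ u ℚ.* last u) ⟩
  ι (suc s) ℚ.* (∑ words φ ℚ.- ∑ words (λ u → φ u ℚ.* last u))
    ≡⟨ cong (ι (suc s) ℚ.*_) (trans
         (∑-cong words λ u → cong (φ u ℚ.*_) (𝟙-avoids-last c u)) (∑-complement last)) ⟨
  ι (suc s) ℚ.* ∑ words (λ u → φ u ℚ.* 𝟙 (avoids? (Fin._≟ fromℕ s) c u)) ∎
  where
  words : List (Vec (Fin k) (suc s))
  words = colorings (suc s) k

  last : Vec (Fin k) (suc s) → ℚ
  last u = 𝟙 (c Fin.≟ lookup u (fromℕ s))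

  ∑-complement : (f : Vec (Fin k) (suc s) → ℚ) →
    ∑ words (λ u → φ u ℚ.* (1ℚ ℚ.- f u)) ≡ ∑ words φ ℚ.- ∑ words (λ u → φ u ℚ.* f u)
  ∑-complement f = begin
    ∑ words (λ u → φ u ℚ.* (1ℚ ℚ.- f u))
      ≡⟨ ∑-cong words (λ u → solve 2 (λ x y → x :* (con 1ℚ :- y) := x :+ con (ℚ.- 1ℚ) :* (x :* y)) refl (φ u) (f u)) ⟩
    ∑ words (λ u → φ u ℚ.+ ℚ.- 1ℚ ℚ.* (φ u ℚ.* f u))
      ≡⟨ ∑-+ words φ (λ u → ℚ.- 1ℚ ℚ.* (φ u ℚ.* f u)) ⟩
    ∑ words φ ℚ.+ ∑ words (λ u → ℚ.- 1ℚ ℚ.* (φ u ℚ.* f u))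
      ≡⟨ cong (∑ words φ ℚ.+_) (∑-*ˡ (ℚ.- 1ℚ) words (λ u → φ u ℚ.* f u)) ⟩
    ∑ words φ ℚ.+ ℚ.- 1ℚ ℚ.* ∑ words (λ u → φ u ℚ.* f u)
      ≡⟨ solve 2 (λ x y → x :+ con (ℚ.- 1ℚ) :* y := x :- y) refl (∑ words φ) _ ⟩
    ∑ words φ ℚ.- ∑ words (λ u → φ u ℚ.* f u) ∎

  avoid-all : ∀ u → φ u ℚ.* 𝟙 (avoids? ⊤? c u) ≡ φ u ℚ.* (1ℚ ℚ.- ι (occ c u))
  avoid-all u = begin
    φ u ℚ.* 𝟙 (avoids? ⊤? c u)
      ≡⟨ rearrange (𝟙 (avoids? ⊤? c u)) ⟩
    ψ u ℚ.* (𝟙 (distinct? u) ℚ.* 𝟙 (avoids? ⊤? c u))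
      ≡⟨ cong (ψ u ℚ.*_) (𝟙-distinct-avoids c u) ⟩
    ψ u ℚ.* (𝟙 (distinct? u) ℚ.* (1ℚ ℚ.- ι (occ c u)))
      ≡⟨ rearrange (1ℚ ℚ.- ι (occ c u)) ⟨
    φ u ℚ.* (1ℚ ℚ.- ι (occ c u)) ∎
    where
    rearrange : ∀ q → φ u ℚ.* q ≡ ψ u ℚ.* (𝟙 (distinct? u) ℚ.* q)
    rearrange q = trans (cong (ℚ._* q) (φ≡ u))
      (solve 3 (λ x y z → x :* y :* z := y :* (x :* z)) refl (𝟙 (distinct? u)) (ψ u) q)

-- Here m = s + 2. For each coloring of the path, `avoids-recurrence` is applied with c the color of
-- its first vertex; summing over the path colorings gives the identity.
X-L-recurrence : ∀ {N} s n (eq : 2 + s + n ≡ N) (eq′ : suc s + suc n ≡ N) k (α : Vec ℕ k) →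
  X (graph (L (2 + s) n eq)) k α ℚ.+ ι s ℚ.* (X (graph (K (suc s))) · X (graph (P (suc n)))) k α ≡
  ι (suc s) ℚ.* X (graph (L (suc s) (suc n) eq′)) k α
X-L-recurrence s n eq refl k α = begin
  X (graph (L (2 + s) n eq)) k α ℚ.+ ι s ℚ.* (X (graph (K (suc s))) · X (graph (P (suc n)))) k α
    ≡⟨ cong₂ (λ p q → p ℚ.+ ι s ℚ.* q)
         (X-attachment α ⊤? (L-suc-attachment (suc s) n eq)) (X-K·X-P {suc s} {n} α) ⟩
  ∑ tails (λ w → path w ℚ.* ∑ words (all w)) ℚ.+ ι s ℚ.* ∑ tails (λ w → path w ℚ.* ∑ words (free w))
    ≡⟨ cong (∑ tails (λ w → path w ℚ.* ∑ words (all w)) ℚ.+_)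
         (∑-*ˡ (ι s) tails (λ w → path w ℚ.* ∑ words (free w))) ⟨
  ∑ tails (λ w → path w ℚ.* ∑ words (all w)) ℚ.+ ∑ tails (λ w → ι s ℚ.* (path w ℚ.* ∑ words (free w)))
    ≡⟨ ∑-+ tails (λ w → path w ℚ.* ∑ words (all w)) (λ w → ι s ℚ.* (path w ℚ.* ∑ words (free w))) ⟨
  ∑ tails (λ w → path w ℚ.* ∑ words (all w) ℚ.+ ι s ℚ.* (path w ℚ.* ∑ words (free w)))
    ≡⟨ ∑-cong tails (λ w → begin
         path w ℚ.* ∑ words (all w) ℚ.+ ι s ℚ.* (path w ℚ.* ∑ words (free w))
           ≡⟨ solve 4 (λ x y z t → x :* y :+ z :* (x :* t) := x :* (y :+ z :* t)) refl
                (path w) (∑ words (all w)) (ι s) (∑ words (free w)) ⟩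
         path w ℚ.* (∑ words (all w) ℚ.+ ι s ℚ.* ∑ words (free w))
           ≡⟨ cong (path w ℚ.*_) (avoids-recurrence (lookup w zero) (λ _ → refl) (completion-symmetric α w)) ⟩
         path w ℚ.* (ι (suc s) ℚ.* ∑ words (last w))
           ≡⟨ solve 3 (λ x y z → x :* (y :* z) := y :* (x :* z)) refl (path w) (ι (suc s)) (∑ words (last w)) ⟩
         ι (suc s) ℚ.* (path w ℚ.* ∑ words (last w)) ∎) ⟩
  ∑ tails (λ w → ι (suc s) ℚ.* (path w ℚ.* ∑ words (last w)))
    ≡⟨ ∑-*ˡ (ι (suc s)) tails (λ w → path w ℚ.* ∑ words (last w)) ⟩
  ι (suc s) ℚ.* ∑ tails (λ w → path w ℚ.* ∑ words (last w))
    ≡⟨ cong (ι (suc s) ℚ.*_) (X-attachment α (Fin._≟ fromℕ s) (L-last-attachment s n refl)) ⟨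
  ι (suc s) ℚ.* X (graph (L (suc s) (suc n) refl)) k α ∎
  where
  tails : List (Vec (Fin k) (suc n))
  tails = colorings (suc n) k

  words : List (Vec (Fin k) (suc s))
  words = colorings (suc s) k

  path : Vec (Fin k) (suc n) → ℚ
  path w = 𝟙 (proper? (graph (P (suc n))) w)

  free all last : Vec (Fin k) (suc n) → Vec (Fin k) (suc s) → ℚ
  free = completion α
  all  w u = free w u ℚ.* 𝟙 (avoids? ⊤? (lookup w zero) u)
  last w u = free w u ℚ.* 𝟙 (avoids? (Fin._≟ fromℕ s) (lookup w zero) u)

-- Expansions in elementary symmetric functions

infix 4 _≟ˡ_
_≟ˡ_ : (lam mu : List ℕ) → Dec (lam ≡ mu)
_≟ˡ_ = List.≡-dec ℕ._≟_

IsComposition : ℕ → List ℕ → Set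
IsComposition n lam = AllL.All (1 ≤_) lam × sum lam ≡ n

-- A named copy of the local function inside `compositions`, so that lemmas can speak about it.
extend : List ℕ → List (List ℕ)
extend []       = (1 ∷ []) ∷ []
extend (a ∷ as) = (1 ∷ a ∷ as) ∷ (suc a ∷ as) ∷ []

compositions-suc : ∀ n → compositions (suc n) ≡ concatMap extend (compositions n)
compositions-suc n = List.concatMap-cong (λ { [] → refl ; (_ ∷ _) → refl }) (compositions n)

compositions-sound : ∀ n → AllL.All (IsComposition n) (compositions n)
compositions-sound zero    = (AllL.[] , refl) AllL.∷ AllL.[]
compositions-sound (suc n) = subst (AllL.All (IsComposition (suc n))) (sym (compositions-suc n))
  (AllL.concat⁺ (AllL.map⁺ (AllL.map (extend-sound _) (compositions-sound n))))
  where
  extend-sound : ∀ as → IsComposition n as → AllL.All (IsComposition (suc n)) (extend as)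
  extend-sound []       (as≥1 , eq) = ((ℕ.≤-refl AllL.∷ AllL.[]) , cong suc eq) AllL.∷ AllL.[]
  extend-sound (a ∷ as) ((a≥1 AllL.∷ as≥1) , eq) =
            ((ℕ.≤-refl AllL.∷ a≥1 AllL.∷ as≥1) , cong suc eq)
    AllL.∷ ((s≤s z≤n AllL.∷ as≥1) , cong suc eq)
    AllL.∷ AllL.[]

-- This says that `lam` is listed exactly once. The induction undoes the extension that produced it:
-- a leading 1 is removed, a larger first part is decreased.
∑-compositions-𝟙 : ∀ n lam → IsComposition n lam → (f : List ℕ → ℚ) →
  ∑ (compositions n) (λ mu → 𝟙 (lam ≟ˡ mu) ℚ.* f mu) ≡ f lam
∑-compositions-𝟙 zero    []      _ f = trans (ℚ.+-identityʳ _) (ℚ.*-identityˡ (f []))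
∑-compositions-𝟙 zero    (zero ∷ _) ((() AllL.∷ _) , _) f
∑-compositions-𝟙 (suc n) (zero ∷ _) ((() AllL.∷ _) , _) f
∑-compositions-𝟙 (suc n) (1 ∷ lam) ((_ AllL.∷ lam≥1) , eq) f = begin
  ∑ (compositions (suc n)) g
    ≡⟨ trans (cong (λ cs → ∑ cs g) (compositions-suc n)) (∑-concatMap extend (compositions n) g) ⟩
  ∑ (compositions n) (λ mu → ∑ (extend mu) g)
    ≡⟨ ∑-cong-∈ (compositions n) (λ mu mu∈ → inner mu (proj₁ (AllL.lookup (compositions-sound n) mu∈))) ⟩
  ∑ (compositions n) (λ mu → 𝟙 (lam ≟ˡ mu) ℚ.* f (1 ∷ mu))
    ≡⟨ ∑-compositions-𝟙 n lam (lam≥1 , ℕ.suc-injective eq) (f ∘ (1 ∷_)) ⟩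
  f (1 ∷ lam) ∎
  where
  g : List ℕ → ℚ
  g mu = 𝟙 (1 ∷ lam ≟ˡ mu) ℚ.* f mu

  -- A first part 0 would be increased to 1 and could match `1 ∷ lam` a second time; positivity of
  -- the parts excludes this.
  inner : ∀ mu → AllL.All (1 ≤_) mu → ∑ (extend mu) g ≡ 𝟙 (lam ≟ˡ mu) ℚ.* f (1 ∷ mu)
  inner []             _ = ℚ.+-identityʳ _
  inner (zero ∷ as)    (() AllL.∷ _)
  inner (suc a ∷ as)   _ = trans
    (cong (λ q → 𝟙 (lam ≟ˡ suc a ∷ as) ℚ.* f (1 ∷ suc a ∷ as) ℚ.+ (q ℚ.+ 0ℚ)) (ℚ.*-zeroˡ (f (2 + a ∷ as))))
    (ℚ.+-identityʳ _)
∑-compositions-𝟙 (suc n) (suc (suc b) ∷ lam) ((_ AllL.∷ lam≥1) , eq) f = begin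
  ∑ (compositions (suc n)) g
    ≡⟨ trans (cong (λ cs → ∑ cs g) (compositions-suc n)) (∑-concatMap extend (compositions n) g) ⟩
  ∑ (compositions n) (λ mu → ∑ (extend mu) g)
    ≡⟨ ∑-cong (compositions n) inner ⟩
  ∑ (compositions n) (λ mu → 𝟙 (suc b ∷ lam ≟ˡ mu) ℚ.* f (increase mu))
    ≡⟨ ∑-compositions-𝟙 n (suc b ∷ lam) ((s≤s z≤n AllL.∷ lam≥1) , ℕ.suc-injective eq) (f ∘ increase) ⟩
  f (2 + b ∷ lam) ∎
  where
  g : List ℕ → ℚ
  g mu = 𝟙 (2 + b ∷ lam ≟ˡ mu) ℚ.* f mu

  -- The value at `[]` is a mere default: the indicator in front of it is zero there.
  increase : List ℕ → List ℕ
  increase []       = []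
  increase (a ∷ as) = suc a ∷ as

  inner : ∀ mu → ∑ (extend mu) g ≡ 𝟙 (suc b ∷ lam ≟ˡ mu) ℚ.* f (increase mu)
  inner []       = trans (cong (ℚ._+ 0ℚ) (ℚ.*-zeroˡ (f (1 ∷ [])))) (sym (ℚ.*-zeroˡ (f [])))
  inner (a ∷ as) = trans
    (cong (ℚ._+ (𝟙 (suc b ∷ lam ≟ˡ a ∷ as) ℚ.* f (suc a ∷ as) ℚ.+ 0ℚ)) (ℚ.*-zeroˡ (f (1 ∷ a ∷ as))))
    (trans (ℚ.+-identityˡ _) (ℚ.+-identityʳ _))

record IsPartition (n : ℕ) (lam : List ℕ) : Set where
  field
    isComposition : IsComposition n lam
    decreasing    : Linked ℕ._≥_ lam

open IsPartition

partitions-sound : ∀ {n lam} → lam ∈ˡ partitions n → IsPartition n lam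
partitions-sound {n} lam∈ with lam∈compositions , linked ← ∈-filter⁻ (linked? ℕ._≥?_) lam∈ = record
  { isComposition = AllL.lookup (compositions-sound n) lam∈compositions
  ; decreasing    = linked
  }

∑-partitions-𝟙 : ∀ {n lam} → IsPartition n lam → (f : List ℕ → ℚ) →
  ∑ (partitions n) (λ mu → 𝟙 (lam ≟ˡ mu) ℚ.* f mu) ≡ f lam
∑-partitions-𝟙 {n} {lam} isPartition f = begin
  ∑ (partitions n) (λ mu → 𝟙 (lam ≟ˡ mu) ℚ.* f mu)
    ≡⟨ ∑-filter (linked? ℕ._≥?_) (compositions n) (λ mu → 𝟙 (lam ≟ˡ mu) ℚ.* f mu) ⟩
  ∑ (compositions n) (λ mu → 𝟙 (linked? ℕ._≥?_ mu) ℚ.* (𝟙 (lam ≟ˡ mu) ℚ.* f mu))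
    ≡⟨ ∑-cong (compositions n) (λ mu →
         solve 3 (λ x y z → x :* (y :* z) := y :* (x :* z)) refl (𝟙 (linked? ℕ._≥?_ mu)) (𝟙 (lam ≟ˡ mu)) (f mu)) ⟩
  ∑ (compositions n) (λ mu → 𝟙 (lam ≟ˡ mu) ℚ.* (𝟙 (linked? ℕ._≥?_ mu) ℚ.* f mu))
    ≡⟨ ∑-compositions-𝟙 n lam (isComposition isPartition) (λ mu → 𝟙 (linked? ℕ._≥?_ mu) ℚ.* f mu) ⟩
  𝟙 (linked? ℕ._≥?_ lam) ℚ.* f lam
    ≡⟨ cong (ℚ._* f lam) (𝟙-yes (linked? ℕ._≥?_ lam) (decreasing isPartition)) ⟩
  1ℚ ℚ.* f lam
    ≡⟨ ℚ.*-identityˡ (f lam) ⟩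
  f lam ∎

singleton-isPartition : ∀ n → IsPartition (suc n) (suc n ∷ [])
singleton-isPartition n = record
  { isComposition = (s≤s z≤n AllL.∷ AllL.[]) , ℕ.+-identityʳ (suc n)
  ; decreasing    = [-]
  }

insert-isPartition : ∀ {n} r {lam} → IsPartition n lam → IsPartition (suc r + n) (insert (suc r) lam)
insert-isPartition r {lam} isPartition = record
  { isComposition =
        Perm.All-resp-↭ (Perm.↭-sym (insert-↭ (suc r) lam)) (s≤s z≤n AllL.∷ proj₁ (isComposition isPartition))
      , trans (sum-↭ (insert-↭ (suc r) lam)) (cong (suc r +_) (proj₂ (isComposition isPartition)))
  ; decreasing    = insert-↗ (suc r) (decreasing isPartition)
  }

-- Multiplication by e_r puts r in front, whereas the index must be a sorted list; this lemma
-- reconciles the two.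
e-↭ : ∀ {lam mu} → lam ↭ mu → e lam ≈ˢ e mu
e-↭ Perm.refl        k α = refl
e-↭ (Perm.prep r p)  k α = conv-cong {f = elem r k} (λ _ → refl) (e-↭ p k) α
e-↭ (Perm.swap {xs} r s p) k α = trans
  (conv-leftComm (elem r k) (elem s k) (e xs k) α)
  (conv-cong {f = elem s k} (λ _ → refl) (conv-cong {f = elem r k} (λ _ → refl) (e-↭ p k)) α)
e-↭ (Perm.trans p q) k α = trans (e-↭ p k α) (e-↭ q k α)

-- The content of `EExpansion` with the coefficients as a parameter, so that they can be prescribed
-- and compared.
Expands : ℕ → Series → (List ℕ → ℚ) → Set
Expands N F c = ∀ k α → F k α ≡ ∑ (partitions N) λ lam → c lam ℚ.* e lam k α

-- The coefficients of e_r F when `c` holds those of F: multiplying e_λ by e_r inserts the part r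
-- into λ.
mulElem : ℕ → ℕ → (List ℕ → ℚ) → List ℕ → ℚ
mulElem r n c mu = ∑ (partitions n) λ lam → c lam ℚ.* 𝟙 (insert r lam ≟ˡ mu)

elem-·-expands : ∀ r {n F c} → Expands n F c → Expands (suc r + n) (elem (suc r) · F) (mulElem (suc r) n c)
elem-·-expands r {n} {F} {c} F≡ k α = begin
  conv (elem (suc r) k) (F k) α
    ≡⟨ conv-cong {f = elem (suc r) k} (λ _ → refl) (F≡ k) α ⟩
  conv (elem (suc r) k) (λ β → ∑ (partitions n) λ lam → c lam ℚ.* e lam k β) α
    ≡⟨ conv-∑ʳ (elem (suc r) k) (partitions n) (λ lam β → c lam ℚ.* e lam k β) α ⟩
  ∑ (partitions n) (λ lam → conv (elem (suc r) k) (λ β → c lam ℚ.* e lam k β) α)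
    ≡⟨ ∑-cong-∈ (partitions n) (λ lam lam∈ → begin
         conv (elem (suc r) k) (λ β → c lam ℚ.* e lam k β) α
           ≡⟨ conv-*ʳ (c lam) (elem (suc r) k) (e lam k) α ⟩
         c lam ℚ.* e (suc r ∷ lam) k α
           ≡⟨ cong (c lam ℚ.*_) (e-↭ (insert-↭ (suc r) lam) k α) ⟨
         c lam ℚ.* e (insert (suc r) lam) k α
           ≡⟨ cong (c lam ℚ.*_) (∑-partitions-𝟙 (insert-isPartition r (partitions-sound lam∈)) (λ mu → e mu k α)) ⟨
         c lam ℚ.* ∑ (partitions (suc r + n)) (λ mu → 𝟙 (insert (suc r) lam ≟ˡ mu) ℚ.* e mu k α)
           ≡⟨ ∑-*ˡ (c lam) (partitions (suc r + n)) (λ mu → 𝟙 (insert (suc r) lam ≟ˡ mu) ℚ.* e mu k α) ⟨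
         ∑ (partitions (suc r + n)) (λ mu → c lam ℚ.* (𝟙 (insert (suc r) lam ≟ˡ mu) ℚ.* e mu k α))
           ≡⟨ ∑-cong (partitions (suc r + n)) (λ mu →
                ℚ.*-assoc (c lam) (𝟙 (insert (suc r) lam ≟ˡ mu)) (e mu k α)) ⟨
         ∑ (partitions (suc r + n)) (λ mu → c lam ℚ.* 𝟙 (insert (suc r) lam ≟ˡ mu) ℚ.* e mu k α) ∎) ⟩
  ∑ (partitions n) (λ lam → ∑ (partitions (suc r + n)) λ mu →
    c lam ℚ.* 𝟙 (insert (suc r) lam ≟ˡ mu) ℚ.* e mu k α)
    ≡⟨ ∑-swap (partitions n) (partitions (suc r + n))
         (λ lam mu → c lam ℚ.* 𝟙 (insert (suc r) lam ≟ˡ mu) ℚ.* e mu k α) ⟩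
  ∑ (partitions (suc r + n)) (λ mu → ∑ (partitions n) λ lam →
    c lam ℚ.* 𝟙 (insert (suc r) lam ≟ˡ mu) ℚ.* e mu k α)
    ≡⟨ ∑-cong (partitions (suc r + n)) (λ mu →
         ∑-*ʳ (e mu k α) (partitions n) (λ lam → c lam ℚ.* 𝟙 (insert (suc r) lam ≟ˡ mu))) ⟩
  ∑ (partitions (suc r + n)) (λ mu → mulElem (suc r) n c mu ℚ.* e mu k α) ∎

*-≥0 : ∀ {p q} → 0ℚ ℚ.≤ p → 0ℚ ℚ.≤ q → 0ℚ ℚ.≤ p ℚ.* q
*-≥0 {p} {q} p≥0 q≥0 = subst (ℚ._≤ p ℚ.* q) (ℚ.*-zeroʳ p)
  (ℚ.*-monoˡ-≤-nonNeg p {{ℚ.nonNegative p≥0}} q≥0)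

mulElem≥0 : ∀ r n {c} → (∀ lam → 0ℚ ℚ.≤ c lam) → ∀ mu → 0ℚ ℚ.≤ mulElem r n c mu
mulElem≥0 r n c≥0 mu = ∑-≥0 (partitions n) λ lam _ → *-≥0 (c≥0 lam) (𝟙≥0 (insert r lam ≟ˡ mu))

-- A partition of a positive number has a part already, so inserting another yields at least two.
-- The degree `suc n` matters, as the empty partition of 0 would give the single part r.
mulElem-singleton : ∀ r n c N → mulElem r (suc n) c (N ∷ []) ≡ 0ℚ
mulElem-singleton r n c N = trans
  (∑-cong-∈ (partitions (suc n)) λ lam lam∈ →
    trans (cong (c lam ℚ.*_) (𝟙-no (insert r lam ≟ˡ N ∷ []) (long lam (partitions-sound lam∈))))
          (ℚ.*-zeroʳ (c lam)))
  (∑-zero (partitions (suc n)))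
  where
  long : ∀ lam → IsPartition (suc n) lam → insert r lam ≢ N ∷ []
  long []        isPartition _  = contradiction (proj₂ (isComposition isPartition)) λ ()
  long (a ∷ lam) _           eq =
    contradiction (trans (sym (Perm.↭-length (insert-↭ r (a ∷ lam)))) (cong List.length eq)) λ ()

-- Explicit coefficients of the lollipop graphs

ι≥0 : ∀ n → 0ℚ ℚ.≤ ι n
ι≥0 zero    = ℚ.≤-refl
ι≥0 (suc n) = ℚ.+-mono-≤ (ℚ.nonNegative⁻¹ 1ℚ) (ι≥0 n)

ι-suc-positive : ∀ n → ℚ.Positive (ι (suc n))
ι-suc-positive n = ℚ.pos+nonNeg⇒pos 1ℚ (ι n) {{ℚ.nonNegative (ι≥0 n)}}

ι-!-positive : ∀ n → ℚ.Positive (ι (n !))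
ι-!-positive n = subst (ℚ.Positive ∘ ι) (ℕ.suc-pred (n !) {{n!≢0}}) (ι-suc-positive (ℕ.pred (n !)))
  where
  n!≢0 : ℕ.NonZero (n !)
  n!≢0 = ℕ.>-nonZero (n!>0 n)
    where
    n!>0 : ∀ n → 1 ≤ n !
    n!>0 zero    = ℕ.≤-refl
    n!>0 (suc n) = ℕ.≤-trans (n!>0 n) (ℕ.m≤m+n (n !) (n ℕ.* n !))

recip : ℕ → ℚ
recip n = (ℚ.1/ ι (suc n)) {{ℚ.pos⇒nonZero (ι (suc n)) {{ι-suc-positive n}}}}

recip-inverse : ∀ n → recip n ℚ.* ι (suc n) ≡ 1ℚ
recip-inverse n = ℚ.*-inverseˡ (ι (suc n)) {{ℚ.pos⇒nonZero (ι (suc n)) {{ι-suc-positive n}}}}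

recip-positive : ∀ n → ℚ.Positive (recip n)
recip-positive n = ℚ.1/pos⇒pos (ι (suc n)) {{ι-suc-positive n}}

recip≥0 : ∀ n → 0ℚ ℚ.≤ recip n
recip≥0 n = ℚ.<⇒≤ (ℚ.positive⁻¹ (recip n) {{recip-positive n}})

-- Solving X-L-recurrence for L_{s+1,n+1}, with X_{K_{s+1}} = (s+1)! e_{s+1} and P_{n+1} = L_{1,n}.
lollipopCoeff : ℕ → ℕ → List ℕ → ℚ
lollipopCoeff s zero    lam = ι (suc s !) ℚ.* 𝟙 (suc s ∷ [] ≟ˡ lam)
lollipopCoeff s (suc n) lam = recip s ℚ.* lollipopCoeff (suc s) n lam
  ℚ.+ ι s ℚ.* ι (s !) ℚ.* mulElem (suc s) (suc n) (lollipopCoeff 0 n) lam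

-- Induction on the tail with the clique size left general, since the step calls the claim for the
-- larger clique `suc s` and for the path, both with tail n.
lollipopCoeff-expands : ∀ {N} s n (eq : suc s + n ≡ N) →
                        Expands N (X (graph (L (suc s) n eq))) (lollipopCoeff s n)
lollipopCoeff-expands s zero eq with refl ← trans (sym (ℕ.+-identityʳ (suc s))) eq = λ k α → begin
  X (graph (L (suc s) 0 eq)) k α
    ≡⟨ X-L-0 (suc s) eq k α ⟩
  X (graph (K (suc s))) k α
    ≡⟨ X-K (suc s) k α ⟩
  ι (suc s !) ℚ.* elem (suc s) k α
    ≡⟨ cong (ι (suc s !) ℚ.*_) (conv-elem-0ʳ (elem (suc s) k) α) ⟨
  ι (suc s !) ℚ.* e (suc s ∷ []) k α
    ≡⟨ cong (ι (suc s !) ℚ.*_) (∑-partitions-𝟙 (singleton-isPartition s) (λ lam → e lam k α)) ⟨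
  ι (suc s !) ℚ.* ∑ (partitions (suc s)) (λ lam → 𝟙 (suc s ∷ [] ≟ˡ lam) ℚ.* e lam k α)
    ≡⟨ ∑-*ˡ (ι (suc s !)) (partitions (suc s)) (λ lam → 𝟙 (suc s ∷ [] ≟ˡ lam) ℚ.* e lam k α) ⟨
  ∑ (partitions (suc s)) (λ lam → ι (suc s !) ℚ.* (𝟙 (suc s ∷ [] ≟ˡ lam) ℚ.* e lam k α))
    ≡⟨ ∑-cong (partitions (suc s)) (λ lam →
         ℚ.*-assoc (ι (suc s !)) (𝟙 (suc s ∷ [] ≟ˡ lam)) (e lam k α)) ⟨
  ∑ (partitions (suc s)) (λ lam → lollipopCoeff s 0 lam ℚ.* e lam k α) ∎
lollipopCoeff-expands s (suc n) refl k α = begin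
  X-L
    ≡⟨ ℚ.*-identityˡ X-L ⟨
  1ℚ ℚ.* X-L
    ≡⟨ cong (ℚ._* X-L) (recip-inverse s) ⟨
  recip s ℚ.* ι (suc s) ℚ.* X-L
    ≡⟨ ℚ.*-assoc (recip s) (ι (suc s)) X-L ⟩
  recip s ℚ.* (ι (suc s) ℚ.* X-L)
    ≡⟨ cong (recip s ℚ.*_) (X-L-recurrence s n eq′ refl k α) ⟨
  recip s ℚ.* (X (graph (L (2 + s) n eq′)) k α ℚ.+ ι s ℚ.* (X (graph (K (suc s))) · X (graph (P (suc n)))) k α)
    ≡⟨ cong₂ (λ p q → recip s ℚ.* (p ℚ.+ ι s ℚ.* q)) (lollipopCoeff-expands (suc s) n eq′ k α) product ⟩
  recip s ℚ.* (∑a ℚ.+ ι s ℚ.* (ι (suc s) ℚ.* ι (s !) ℚ.* ∑b))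
    -- The reciprocal of s + 1 is brought next to the factor s + 1 of (s + 1)!; after they cancel, s
    -- · s! remains in front of the product term.
    ≡⟨ solve 6 (λ x y z t a b → x :* (a :+ y :* (z :* t :* b)) := x :* a :+ (x :* z) :* (y :* t :* b)) refl
         (recip s) (ι s) (ι (suc s)) (ι (s !)) ∑a ∑b ⟩
  recip s ℚ.* ∑a ℚ.+ recip s ℚ.* ι (suc s) ℚ.* (ι s ℚ.* ι (s !) ℚ.* ∑b)
    ≡⟨ cong (recip s ℚ.* ∑a ℚ.+_) (trans (cong (ℚ._* (ι s ℚ.* ι (s !) ℚ.* ∑b)) (recip-inverse s)) (ℚ.*-identityˡ _)) ⟩
  recip s ℚ.* ∑a ℚ.+ ι s ℚ.* ι (s !) ℚ.* ∑b
    ≡⟨ cong₂ ℚ._+_ (∑-*ˡ (recip s) (partitions N) a) (∑-*ˡ (ι s ℚ.* ι (s !)) (partitions N) b) ⟨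
  ∑ (partitions N) (λ lam → recip s ℚ.* a lam) ℚ.+ ∑ (partitions N) (λ lam → ι s ℚ.* ι (s !) ℚ.* b lam)
    ≡⟨ ∑-+ (partitions N) (λ lam → recip s ℚ.* a lam) (λ lam → ι s ℚ.* ι (s !) ℚ.* b lam) ⟨
  ∑ (partitions N) (λ lam → recip s ℚ.* a lam ℚ.+ ι s ℚ.* ι (s !) ℚ.* b lam)
    ≡⟨ ∑-cong (partitions N) (λ lam →
         solve 5 (λ x y c d v → x :* (c :* v) :+ y :* (d :* v) := (x :* c :+ y :* d) :* v) refl
           (recip s) (ι s ℚ.* ι (s !)) (lollipopCoeff (suc s) n lam)
           (mulElem (suc s) (suc n) (lollipopCoeff 0 n) lam) (e lam k α)) ⟩
  ∑ (partitions N) (λ lam → lollipopCoeff s (suc n) lam ℚ.* e lam k α) ∎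
  where
  N   = suc s + suc n
  eq′ : 2 + s + n ≡ N
  eq′ = cong suc (sym (ℕ.+-suc s n))
  X-L = X (graph (L (suc s) (suc n) refl)) k α

  a b : List ℕ → ℚ
  a lam = lollipopCoeff (suc s) n lam ℚ.* e lam k α
  b lam = mulElem (suc s) (suc n) (lollipopCoeff 0 n) lam ℚ.* e lam k α
  ∑a = ∑ (partitions N) a
  ∑b = ∑ (partitions N) b

  path : Expands (suc n) (X (graph (P (suc n)))) (lollipopCoeff 0 n)
  path k β = trans (sym (X-L-1 n refl k β)) (lollipopCoeff-expands 0 n refl k β)

  product : (X (graph (K (suc s))) · X (graph (P (suc n)))) k α ≡ ι (suc s) ℚ.* ι (s !) ℚ.* ∑b
  product = begin
    conv (X (graph (K (suc s))) k) (X (graph (P (suc n))) k) α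
      ≡⟨ conv-cong {g = X (graph (P (suc n))) k} (X-K (suc s) k) (λ _ → refl) α ⟩
    conv (λ β → ι (suc s !) ℚ.* elem (suc s) k β) (X (graph (P (suc n))) k) α
      ≡⟨ conv-*ˡ (ι (suc s !)) (elem (suc s) k) (X (graph (P (suc n))) k) α ⟩
    ι (suc s !) ℚ.* (elem (suc s) · X (graph (P (suc n)))) k α
      ≡⟨ cong₂ ℚ._*_ (ι-* (suc s) (s !)) (elem-·-expands s {F = X (graph (P (suc n)))} {c = lollipopCoeff 0 n} path k α) ⟩
    ι (suc s) ℚ.* ι (s !) ℚ.* ∑b ∎

lollipopCoeff≥0 : ∀ s n lam → 0ℚ ℚ.≤ lollipopCoeff s n lam
-- Separated from the positivity of the whole coefficient because this summand alone is the
-- coefficient of X_e(L_{s+1,n+1}, L_{s+2,n}).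
addition≥0      : ∀ s n lam → 0ℚ ℚ.≤ ι s ℚ.* ι (s !) ℚ.* mulElem (suc s) (suc n) (lollipopCoeff 0 n) lam

lollipopCoeff≥0 s zero    lam = *-≥0 (ι≥0 (suc s !)) (𝟙≥0 (suc s ∷ [] ≟ˡ lam))
lollipopCoeff≥0 s (suc n) lam =
  ℚ.+-mono-≤ (*-≥0 (recip≥0 s) (lollipopCoeff≥0 (suc s) n lam)) (addition≥0 s n lam)

addition≥0 s n lam =
  *-≥0 (*-≥0 (ι≥0 s) (ι≥0 (s !))) (mulElem≥0 (suc s) (suc n) (lollipopCoeff≥0 0 n) lam)

-- The product term involves only e_λ with at least two parts, so the single-part coefficients of
-- neighboring lollipops differ by the factor `recip s`.
lollipopCoeff-suc-singleton : ∀ s n N →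
  lollipopCoeff s (suc n) (N ∷ []) ≡ recip s ℚ.* lollipopCoeff (suc s) n (N ∷ [])
lollipopCoeff-suc-singleton s n N = begin
  recip s ℚ.* lollipopCoeff (suc s) n (N ∷ [])
    ℚ.+ ι s ℚ.* ι (s !) ℚ.* mulElem (suc s) (suc n) (lollipopCoeff 0 n) (N ∷ [])
    ≡⟨ cong (λ q → recip s ℚ.* lollipopCoeff (suc s) n (N ∷ []) ℚ.+ ι s ℚ.* ι (s !) ℚ.* q)
         (mulElem-singleton (suc s) n (lollipopCoeff 0 n) N) ⟩
  recip s ℚ.* lollipopCoeff (suc s) n (N ∷ []) ℚ.+ ι s ℚ.* ι (s !) ℚ.* 0ℚ
    ≡⟨ trans (cong (recip s ℚ.* lollipopCoeff (suc s) n (N ∷ []) ℚ.+_) (ℚ.*-zeroʳ (ι s ℚ.* ι (s !))))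
             (ℚ.+-identityʳ _) ⟩
  recip s ℚ.* lollipopCoeff (suc s) n (N ∷ []) ∎

-- Up to positive factors `recip s` this is the coefficient for the complete graph, which is N!.
lollipopCoeff-singleton-positive : ∀ {N} s n → suc s + n ≡ N → ℚ.Positive (lollipopCoeff s n (N ∷ []))
lollipopCoeff-singleton-positive s zero eq with refl ← trans (sym (ℕ.+-identityʳ (suc s))) eq =
  subst ℚ.Positive
    (sym (trans (cong (ι (suc s !) ℚ.*_) (𝟙-yes (suc s ∷ [] ≟ˡ suc s ∷ []) refl)) (ℚ.*-identityʳ (ι (suc s !)))))
    (ι-!-positive (suc s))
lollipopCoeff-singleton-positive {N} s (suc n) eq =
  subst ℚ.Positive (sym (lollipopCoeff-suc-singleton s n N))
    (ℚ.pos*pos⇒pos (recip s) {{recip-positive s}} (lollipopCoeff (suc s) n (N ∷ []))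
      {{lollipopCoeff-singleton-positive (suc s) n (trans (cong suc (sym (ℕ.+-suc s n))) eq)}})

-- Comparison of expansions

-- The order on the level of coefficients, with the quotient of the e_(N)-coefficients replaced by a
-- number satisfying the cross-multiplied equation. Without division, composing comparisons is plain
-- algebra.
record Dominates (N : ℕ) (c d : List ℕ → ℚ) : Set where
  field
    ratio      : ℚ
    ratio≥0    : 0ℚ ℚ.≤ ratio
    singleton  : c (N ∷ []) ≡ ratio ℚ.* d (N ∷ [])
    difference : ∀ lam → 0ℚ ℚ.≤ c lam ℚ.- ratio ℚ.* d lam

open Dominates

dominates-refl : ∀ {N} c → Dominates N c c
dominates-refl {N} c = record
  { ratio      = 1ℚ
  ; ratio≥0    = ℚ.nonNegative⁻¹ 1ℚ
  ; singleton  = sym (ℚ.*-identityˡ (c (N ∷ [])))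
  ; difference = λ lam → ℚ.≤-reflexive (solve 1 (λ x → con 0ℚ := x :- con 1ℚ :* x) refl (c lam))
  }

-- With ratios x and y, c - xy f = (c - x d) + x (d - y f), and x ≥ 0 keeps the second term
-- nonnegative.
dominates-trans : ∀ {N c d f} → Dominates N c d → Dominates N d f → Dominates N c f
dominates-trans {N} {c} {d} {f} D E = record
  { ratio      = ratio D ℚ.* ratio E
  ; ratio≥0    = *-≥0 (ratio≥0 D) (ratio≥0 E)
  ; singleton  = trans (singleton D) (trans (cong (ratio D ℚ.*_) (singleton E))
                   (sym (ℚ.*-assoc (ratio D) (ratio E) (f (N ∷ [])))))
  ; difference = λ lam → subst (0ℚ ℚ.≤_)
      (solve 5 (λ x y c d f → (c :- x :* d) :+ x :* (d :- y :* f) := c :- x :* y :* f) refl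
        (ratio D) (ratio E) (c lam) (d lam) (f lam))
      (ℚ.+-mono-≤ (difference D lam) (*-≥0 (ratio≥0 D) (difference E lam)))
  }

-- Each of the d steps moves one vertex from the tail into the clique.
lollipopCoeff-dominates : ∀ {N} d s n → Dominates N (lollipopCoeff s (d + n)) (lollipopCoeff (d + s) n)
lollipopCoeff-dominates zero    s n = dominates-refl (lollipopCoeff s n)
lollipopCoeff-dominates {N} (suc d) s n = dominates-trans step
  (subst (λ t → Dominates N (lollipopCoeff (suc s) (d + n)) (lollipopCoeff t n)) (ℕ.+-suc d s)
         (lollipopCoeff-dominates d (suc s) n))
  where
  step : Dominates N (lollipopCoeff s (suc (d + n))) (lollipopCoeff (suc s) (d + n))
  step = record
    { ratio      = recip s
    ; ratio≥0    = recip≥0 s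
    ; singleton  = lollipopCoeff-suc-singleton s (d + n) N
    -- Subtracting `recip s` times the second coefficient from the recursive formula leaves exactly
    -- the added product term.
    ; difference = λ lam → subst (0ℚ ℚ.≤_)
        (solve 2 (λ x y → y := x :+ y :- x) refl (recip s ℚ.* lollipopCoeff (suc s) (d + n) lam) _)
        (addition≥0 s (d + n) lam)
    }

dominates⇒≥ₑ : ∀ {N c d} (G H : ConnectedGraph N) → Expands N (X (graph G)) c → Expands N (X (graph H)) d →
               ℚ.Positive (d (N ∷ [])) → Dominates N c d → G ≥ₑ H
dominates⇒≥ₑ {N} {c} {d} G H G≡ H≡ d-positive D = record
  { expansionG = record { coeff = c ; expands = G≡ }
  ; expansionH = record { coeff = d ; expands = H≡ }
  ; nonZeroH   = d≢0
  ; ePositive  = record { coeff = λ lam → c lam ℚ.- q ℚ.* d lam ; expands = expands′ }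
               , λ lam _ → subst (λ t → 0ℚ ℚ.≤ c lam ℚ.- t ℚ.* d lam) (sym q≡ratio) (difference D lam)
  }
  where
  instance
    d≢0 : ℚ.NonZero (d (N ∷ []))
    d≢0 = ℚ.pos⇒nonZero (d (N ∷ [])) {{d-positive}}

  q = c (N ∷ []) ℚ.÷ d (N ∷ [])

  -- The singleton equation determines the ratio, as the coefficient of H at (N) is invertible.
  q≡ratio : q ≡ ratio D
  q≡ratio = begin
    c (N ∷ []) ℚ.* ℚ.1/ d (N ∷ [])                   ≡⟨ cong (ℚ._* ℚ.1/ d (N ∷ [])) (singleton D) ⟩
    ratio D ℚ.* d (N ∷ []) ℚ.* ℚ.1/ d (N ∷ [])       ≡⟨ ℚ.*-assoc (ratio D) (d (N ∷ [])) _ ⟩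
    ratio D ℚ.* (d (N ∷ []) ℚ.* ℚ.1/ d (N ∷ []))     ≡⟨ cong (ratio D ℚ.*_) (ℚ.*-inverseʳ (d (N ∷ []))) ⟩
    ratio D ℚ.* 1ℚ                                   ≡⟨ ℚ.*-identityʳ (ratio D) ⟩
    ratio D                                          ∎

  expands′ : ∀ k α → X (graph G) k α ℚ.- q ℚ.* X (graph H) k α ≡
                     ∑ (partitions N) λ lam → (c lam ℚ.- q ℚ.* d lam) ℚ.* e lam k α
  expands′ k α = begin
    X (graph G) k α ℚ.- q ℚ.* X (graph H) k α
      ≡⟨ cong₂ (λ x y → x ℚ.- q ℚ.* y) (G≡ k α) (H≡ k α) ⟩
    C ℚ.- q ℚ.* D′
      ≡⟨ solve 3 (λ x y z → x :- y :* z := x :+ (:- y) :* z) refl C q D′ ⟩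
    C ℚ.+ (ℚ.- q) ℚ.* D′
      ≡⟨ cong (C ℚ.+_) (∑-*ˡ (ℚ.- q) (partitions N) (λ lam → d lam ℚ.* e lam k α)) ⟨
    C ℚ.+ ∑ (partitions N) (λ lam → (ℚ.- q) ℚ.* (d lam ℚ.* e lam k α))
      ≡⟨ ∑-+ (partitions N) (λ lam → c lam ℚ.* e lam k α) (λ lam → (ℚ.- q) ℚ.* (d lam ℚ.* e lam k α)) ⟨
    ∑ (partitions N) (λ lam → c lam ℚ.* e lam k α ℚ.+ (ℚ.- q) ℚ.* (d lam ℚ.* e lam k α))
      ≡⟨ ∑-cong (partitions N) (λ lam →
           solve 4 (λ x y z v → x :* v :+ (:- y) :* (z :* v) := (x :- y :* z) :* v) refl
             (c lam) q (d lam) (e lam k α)) ⟩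
    ∑ (partitions N) (λ lam → (c lam ℚ.- q ℚ.* d lam) ℚ.* e lam k α) ∎
    where
    C  = ∑ (partitions N) λ lam → c lam ℚ.* e lam k α
    D′ = ∑ (partitions N) λ lam → d lam ℚ.* e lam k α

-- The chain of lollipop graphs

lollipop-≥ₑ : ∀ {N} (G H : ConnectedGraph N) {m n m′ n′} (eq : m + n ≡ N) (eq′ : m′ + n′ ≡ N) →
              G ∼ L m n eq → H ∼ L m′ n′ eq′ → 1 ≤ m → m ≤ m′ → G ≥ₑ H
lollipop-≥ₑ {N} G H {suc s} {n} {m′} {n′} eq eq′ G∼ H∼ _ s<m′
  -- The difference d of the clique sizes is the number of steps. The two matches on `refl` turn
  -- `m′` into `suc (d + s)` and `n` into `d + n′`, the form in which the coefficients are compared.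
  with d ← m′ ∸ suc s in d≡
  with refl ← trans (sym (ℕ.m∸n+n≡m s<m′)) (trans (cong (_+ suc s) d≡) (ℕ.+-suc d s))
  with refl ← ℕ.+-cancelˡ-≡ (suc s) n (d + n′) (trans eq (trans (sym eq′)
    (trans (cong (λ t → suc (t + n′)) (ℕ.+-comm d s)) (cong suc (ℕ.+-assoc s d n′)))))
  = dominates⇒≥ₑ G H
      (λ k α → trans (G∼ k α) (lollipopCoeff-expands s (d + n′) eq k α))
      (λ k α → trans (H∼ k α) (lollipopCoeff-expands (d + s) n′ eq′ k α))
      (lollipopCoeff-singleton-positive (d + s) n′ eq′)
      (lollipopCoeff-dominates d s n′)

theorem3p17 : (N : ℕ) → 1 ≤ N →
    IsChain (Lollipops N)
    × ((m n : ℕ) (3≤m : 3 ≤ m) (m+n≡N : m + n ≡ N) →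
    L (m ∸ 1) (n + 1) (shift 3≤m m+n≡N) ≥ₑ L m n m+n≡N)
    × IsMaximum (Lollipops N) (P N)
    × IsMinimum (Lollipops N) (K N)
theorem3p17 (suc N) _ = chain , adjacent , maximum , minimum
  where
  P∼ : P (suc N) ∼ L 1 N refl
  P∼ k α = sym (X-L-1 N refl k α)

  N+0≡N = ℕ.+-identityʳ (suc N)

  K∼ : K (suc N) ∼ L (suc N) 0 N+0≡N
  K∼ k α = sym (X-L-0 (suc N) N+0≡N k α)

  chain : IsChain (Lollipops (suc N))
  chain G H (m , n , eq , 1≤m , G∼) (m′ , n′ , eq′ , 1≤m′ , H∼) with ℕ.≤-total m m′
  ... | inj₁ m≤m′ = inj₁ (lollipop-≥ₑ G H eq eq′ G∼ H∼ 1≤m m≤m′)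
  ... | inj₂ m′≤m = inj₂ (lollipop-≥ₑ H G eq′ eq H∼ G∼ 1≤m′ m′≤m)

  adjacent : (m n : ℕ) (3≤m : 3 ≤ m) (m+n≡N : m + n ≡ suc N) →
             L (m ∸ 1) (n + 1) (shift 3≤m m+n≡N) ≥ₑ L m n m+n≡N
  adjacent m n 3≤m m+n≡N =
    lollipop-≥ₑ (L (m ∸ 1) (n + 1) (shift 3≤m m+n≡N)) (L m n m+n≡N) (shift 3≤m m+n≡N) m+n≡N
      (λ _ _ → refl) (λ _ _ → refl)
      (ℕ.≤-trans (s≤s z≤n) (ℕ.∸-monoˡ-≤ 1 3≤m)) (ℕ.m∸n≤m m 1)

  maximum : IsMaximum (Lollipops (suc N)) (P (suc N))
  maximum = (1 , N , refl , ℕ.≤-refl , P∼)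
          , λ { G (m , n , eq , 1≤m , G∼) → lollipop-≥ₑ (P (suc N)) G refl eq P∼ G∼ ℕ.≤-refl 1≤m }

  minimum : IsMinimum (Lollipops (suc N)) (K (suc N))
  minimum = (suc N , 0 , N+0≡N , s≤s z≤n , K∼)
          , λ { G (m , n , eq , 1≤m , G∼) →
                lollipop-≥ₑ G (K (suc N)) eq N+0≡N G∼ K∼ 1≤m (ℕ.m+n≤o⇒m≤o m (ℕ.≤-reflexive eq)) }
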